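{- Let $k,n$ be non-negative integers and let $p_1,\dots,p_{k+1}$ be primes with $p_i\equiv 3,5,7\pmod 8$ for each $1\le i\le k+1$. Then for every integer $j$ not divisible by $p_{k+1}$, \[ \mathcal{J}_6\Big(3p_1^2p_2^2\cdots p_k^2\,p_{k+1}\big(8p_{k+1}n+8j+p_{k+1}\big)\Big)\equiv 0\pmod 2. \]
   Context: Let $q=e^{2\pi i\tau}$ with $\tau$ in the upper half-plane, and let $\eta(\tau)=q^{1/24}\prod_{n\ge1}(1-q^n)$ be the Dedekind eta function. The Hauptmodul of $\Gamma_0(6)$ is \[ j_6(\tau)=\left(\frac{\eta(2\tau)\eta(3\tau)^3}{\eta(\tau)\eta(6\tau)^3}\right)^3-3=\frac1q+\sum_{n\ge1}\mathcal{J}_6(n)q^n, \] and $\mathcal{J}_6(n)$ denotes its $n$-th Fourier coefficient (an integer). -}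

module Defs where

open import Data.Nat as ℕ using (ℕ; zero; suc; _%_; _≡ᵇ_)
open import Data.Integer as ℤ using (ℤ; +_; -[1+_]; _+_; _-_; _*_; -_)
open import Data.List as L using (List; []; _∷_; map; upTo; foldr)
open import Data.Vec as V using (Vec)
open import Data.Bool using (if_then_else_)

-- Truncated power series over ℤ: a list of coefficients [a₀, a₁, …].

coeff : List ℤ → ℕ → ℤ
coeff []       _       = + 0
coeff (a ∷ _)  zero    = a
coeff (_ ∷ as) (suc n) = coeff as n

sumTo : ℕ → (ℕ → ℤ) → ℤ
sumTo zero    f = f 0
sumTo (suc n) f = sumTo n f + f (suc n)

mulT : ℕ → List ℤ → List ℤ → List ℤ
mulT L f g = map (λ n → sumTo n (λ i → coeff f i * coeff g (n ℕ.∸ i))) (upTo L)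

oneMinus : ℕ → ℕ → List ℤ
oneMinus L m = map (λ n → if n ≡ᵇ 0 then + 1 else (if n ≡ᵇ m then -[1+ 0 ] else + 0)) (upTo L)

-- 1/(1 - q^(suc m)) = Σ_k q^(k (suc m)), truncated to length L
geom : ℕ → ℕ → List ℤ
geom L m = map (λ n → if (n % suc m) ≡ᵇ 0 then + 1 else + 0) (upTo L)

powT : ℕ → List ℤ → ℕ → List ℤ
powT L f zero    = map (λ n → if n ≡ᵇ 0 then + 1 else + 0) (upTo L)
powT L f (suc e) = mulT L f (powT L f e)

-- The factor of index m = suc m' in
--   F(q) = ∏_{m≥1} (1-q^{2m})^3 (1-q^{3m})^9 / ((1-q^m)^3 (1-q^{6m})^9),
-- so that  (η(2τ)η(3τ)^3 / (η(τ)η(6τ)^3))^3 = q^{-1} F(q).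
factorT : ℕ → ℕ → List ℤ
factorT L m' =
  mulT L (powT L (oneMinus L (2 ℕ.* suc m')) 3)
  (mulT L (powT L (oneMinus L (3 ℕ.* suc m')) 9)
  (mulT L (powT L (geom L m') 3)
          (powT L (geom L (5 ℕ.+ 6 ℕ.* m')) 9)))

prodFactors : ℕ → ℕ → List ℤ
prodFactors L zero    = powT L [] 0
prodFactors L (suc M) = mulT L (factorT L M) (prodFactors L M)

-- coefficient of q^N in F(q) (factors with m > N do not affect it)
Fcoeff : ℕ → ℤ
Fcoeff N = coeff (prodFactors (suc N) N) N

-- 𝒥₆(m) : the coefficient of q^m in j₆(τ) = q^{-1} F(q) - 3, for every m ∈ ℤ
-- (zero for m < -1, equal to 1 for m = -1, and 0 for m = 0).
J6 : ℤ → ℤ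
J6 -[1+ zero ]  = + 1
J6 -[1+ suc _ ] = + 0
J6 (+ zero)     = Fcoeff 1 - + 3
J6 (+ suc n)    = Fcoeff (suc (suc n))

prodSq : {k : ℕ} → Vec ℕ k → ℕ
prodSq = V.foldr _ (λ p acc → p ℕ.* p ℕ.* acc) 1

{-# OPTIONS --safe #-}
-- Modulo 2 the product F is f₁³ / f₃⁹ with f_k = ∏ (1 − q^{km}), and Shanks' finite form of
-- Gauss' identity gives f₁³ ≡ ψ(q) := Σ_k q^{k(k+1)/2}. Write a = ψ(q) and b = ψ(q³), so that
-- F b³ ≡ a. The coefficients of a of index 3n + 1 are those of b, hence the series
-- Y₃ = Σ 𝒥₆(3n) qⁿ (up to its constant term) satisfies Y₃ a³ ≡ b. The theta identity
-- a b ≡ a⁴ + q b⁴ turns this into Y₃ a⁴ ≡ a⁴ + q b⁴; since squares are series in q² modulo 2,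
-- taking the terms of index ≡ 1 modulo 4 yields Y₁₂ a ≡ b, so Y₁₂ a² ≡ a⁴ + q b⁴, and the
-- even terms give Y₂₄ ≡ a. Thus 𝒥₆(3(8m+1)) is odd if and only if m is triangular, i.e. 8m+1
-- is a square, which fails for the indices in question because p_{k+1} divides them to an odd power.
module Submission where

open import Defs
open import Data.Nat using (ℕ; suc; _%_)
open import Data.Nat.Primality using (Prime)
open import Data.Vec using (Vec)
open import Data.Vec.Relation.Unary.All using (All)
open import Data.Sum using (_⊎_)
open import Relation.Binary.PropositionalEquality using (_≡_)
open import Relation.Nullary using (¬_)

-- The theta identity rests on an involution. On ℤ the function T takes each value at m and at -1-m,
-- which have opposite parity, so ψ is the sum of X^T(m) over the integers m of either parity. In
-- the row X^(3T(l)) of ψ(X)ψ(X³) one may therefore let m run over the class of l, say m = 2i - l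
-- with i in ℤ. The exponent 3T(l) + T(m) = 2l² - 2li + 2i² + l + i is then symmetric in l and i.
-- For i ≥ 0 the terms off the diagonal cancel in pairs modulo 2, and the diagonal gives X^(4T(l)),
-- that is ψ⁴. Writing the negative i as -1 - i′ gives an exponent symmetric in l and i′, whose
-- diagonal is 12T(l) + 1, that is Xψ(X³)⁴.
--
-- The series F is known only through truncated products, with a different truncation for each
-- coefficient. Hence equality is taken modulo X^L, infinite sums and products are replaced by
-- finite ones long enough for L, and inverses are supplied separately for each L.

module Parity where

  open import Data.Bool using (Bool; true; false; _∧_; _xor_; if_then_else_)
  import Data.Bool.Properties as 𝔹
  open import Data.Integer as ℤ using (ℤ; -[1+_])
  import Data.Integer.Properties as ℤ
  import Data.Integer.Divisibility as ℤ
  open import Data.Integer.Tactic.RingSolver using () renaming (solve-∀ to ℤ-solve-∀)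
  open import Data.List using (List; []; _∷_; map; upTo; applyUpTo)
  open import Data.Maybe using (Maybe; just; nothing)
  open import Data.Nat using (_+_; _*_; _∸_; _/_; _≤_; _<_; z≤n; s≤s; _≡ᵇ_; _<?_; zero; NonZero; >-nonZero⁻¹)
  import Data.Nat.Properties as ℕ
  open import Data.Nat.Divisibility using (_∣_; divides; ∣m+n∣m⇒∣n; ∣m∣n⇒∣m+n; m∣m*n; ∣⇒≤; ∣-refl)
  open import Data.Nat.DivMod using (m<n⇒m%n≡m; [m+n]%n≡m%n; %-distribˡ-*; [m+kn]%n≡m%n; m≡m%n+[m/n]*n)
  open import Data.Nat.Primality using (euclidsLemma; prime⇒nonZero)
  open import Data.Nat.Tactic.RingSolver using (solve-∀)
  open import Data.Product using (_×_; _,_)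
  open import Data.Sum using (inj₁; inj₂)
  open import Data.Vec using ([]; _∷_)
  open import Data.Vec.Relation.Unary.All using ([]; _∷_)
  open import Function using (id; _∘_)
  open import Relation.Binary.PropositionalEquality
    using (_≢_; refl; sym; trans; cong; cong₂; subst; module ≡-Reasoning)
  open import Relation.Binary.Structures using (IsEquivalence)
  open import Relation.Nullary using (yes; no)
  open import Data.Empty using (⊥-elim)
  open import Level using (0ℓ)
  open import Algebra.Bundles using (CommutativeRing; CommutativeSemiring; RawRing)
  import Algebra.Properties.CommutativeSemiring.Exp
  import Algebra.Solver.Ring
  import Algebra.Solver.Ring.AlmostCommutativeRing as ACR
  open import Algebra.Structures.Biased using (isCommutativeSemiringˡ; isCommutativeMonoidˡ)

  -- The ring F₂[[X]]

  Series : Set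
  Series = ℕ → Bool

  infixl 6 _⊕_
  infixl 7 _⊛_
  infix 4 _≈[_]_

  opaque
    _⊕_ : Series → Series → Series
    (f ⊕ g) n = f n xor g n

    ⊕-at : ∀ f g n → (f ⊕ g) n ≡ f n xor g n
    ⊕-at f g n = refl

  tail : Series → Series
  tail f n = f (suc n)

  opaque
    -- Recursion on the constant term of the left factor, rather than a convolution sum, lets the
    -- ring laws be proved by induction on the index with the series generalized to their tails.
    _⊛_ : Series → Series → Series
    (f ⊛ g) zero    = f 0 ∧ g 0
    (f ⊛ g) (suc n) = (f 0 ∧ g (suc n)) xor (tail f ⊛ g) n

    ⊛-zero : ∀ f g → (f ⊛ g) 0 ≡ f 0 ∧ g 0
    ⊛-zero f g = refl

    ⊛-suc : ∀ f g n → (f ⊛ g) (suc n) ≡ (f 0 ∧ g (suc n)) xor (tail f ⊛ g) n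
    ⊛-suc f g n = refl

  const : Bool → Series
  const b zero    = b
  const b (suc n) = false

  𝟘 𝟙 : Series
  𝟘 n = false
  𝟙   = const true

  -- Equality in F₂[[X]] / (X^L).
  record _≈[_]_ (f : Series) (L : ℕ) (g : Series) : Set where
    constructor mk
    field at : ∀ n → n < L → f n ≡ g n
  open _≈[_]_ public

  everywhere : ∀ {f g L} → (∀ n → f n ≡ g n) → f ≈[ L ] g
  everywhere e = mk λ n _ → e n

  weaken : ∀ {f g L L′} → L′ ≤ L → f ≈[ L ] g → f ≈[ L′ ] g
  weaken l e = mk λ n n< → at e n (ℕ.≤-trans n< l)

  ≈-refl : ∀ {f L} → f ≈[ L ] f
  ≈-refl = mk λ _ _ → refl
  ≈-sym : ∀ {f g L} → f ≈[ L ] g → g ≈[ L ] f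
  ≈-sym e = mk λ n l → sym (at e n l)
  ≈-trans : ∀ {f g h L} → f ≈[ L ] g → g ≈[ L ] h → f ≈[ L ] h
  ≈-trans d e = mk λ n l → trans (at d n l) (at e n l)

  open import Algebra.Properties.CommutativeSemigroup
    (CommutativeRing.+-commutativeSemigroup 𝔹.xor-∧-commutativeRing)
    using () renaming (interchange to xor-interchange; x∙yz≈y∙xz to xor-leftComm)

  ⊕-cong : ∀ {f f′ g g′ L} → f ≈[ L ] f′ → g ≈[ L ] g′ → f ⊕ g ≈[ L ] f′ ⊕ g′
  ⊕-cong d e = mk λ n l → trans (⊕-at _ _ n) (trans (cong₂ _xor_ (at d n l) (at e n l)) (sym (⊕-at _ _ n)))

  opaque
    unfolding _⊕_ _⊛_

    ⊛-cong-at : ∀ {f f′ g g′} n → (∀ m → m ≤ n → f m ≡ f′ m) → (∀ m → m ≤ n → g m ≡ g′ m) →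
                (f ⊛ g) n ≡ (f′ ⊛ g′) n
    ⊛-cong-at zero    d e = cong₂ _∧_ (d 0 z≤n) (e 0 z≤n)
    ⊛-cong-at (suc n) d e = cong₂ _xor_ (cong₂ _∧_ (d 0 z≤n) (e (suc n) ℕ.≤-refl))
      (⊛-cong-at n (λ m l → d (suc m) (s≤s l)) (λ m l → e m (ℕ.m≤n⇒m≤1+n l)))

    ⊛-cong : ∀ {f f′ g g′ L} → f ≈[ L ] f′ → g ≈[ L ] g′ → f ⊛ g ≈[ L ] f′ ⊛ g′
    ⊛-cong d e = mk λ n l → ⊛-cong-at n (λ m m≤n → at d m (ℕ.≤-<-trans m≤n l)) (λ m m≤n → at e m (ℕ.≤-<-trans m≤n l))

    ⊛-distribʳ-at : ∀ f g h n → ((g ⊕ h) ⊛ f) n ≡ (g ⊛ f) n xor (h ⊛ f) n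
    ⊛-distribʳ-at f g h zero    = 𝔹.∧-distribʳ-xor (f 0) (g 0) (h 0)
    ⊛-distribʳ-at f g h (suc n) = trans
      (cong₂ _xor_ (𝔹.∧-distribʳ-xor (f (suc n)) (g 0) (h 0)) (⊛-distribʳ-at f (tail g) (tail h) n))
      (xor-interchange (g 0 ∧ f (suc n)) (h 0 ∧ f (suc n)) _ _)

    scale : Bool → Series → Series
    scale b f n = b ∧ f n

    scale-⊛ : ∀ b f g n → (scale b f ⊛ g) n ≡ b ∧ (f ⊛ g) n
    scale-⊛ b f g zero    = 𝔹.∧-assoc b (f 0) (g 0)
    scale-⊛ b f g (suc n) = trans (cong₂ _xor_ (𝔹.∧-assoc b (f 0) (g (suc n))) (scale-⊛ b (tail f) g n))
      (sym (𝔹.∧-distribˡ-xor b _ _))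

    𝟘-⊛ : ∀ f n → (𝟘 ⊛ f) n ≡ false
    𝟘-⊛ f zero    = refl
    𝟘-⊛ f (suc n) = 𝟘-⊛ f n

    const-⊛ : ∀ b f n → (const b ⊛ f) n ≡ b ∧ f n
    const-⊛ b f zero    = refl
    const-⊛ b f (suc n) = trans (cong ((b ∧ f (suc n)) xor_) (𝟘-⊛ f n)) (𝔹.xor-identityʳ _)

    -- The defining recursion favours the left factor; splitting off the constant term of the right
    -- one is what commutativity and `frobenius` need.
    ⊛-suc′ : ∀ f g n → (f ⊛ g) (suc n) ≡ (f (suc n) ∧ g 0) xor (f ⊛ tail g) n
    ⊛-suc′ f g zero    = 𝔹.xor-comm (f 0 ∧ g 1) (f 1 ∧ g 0)
    ⊛-suc′ f g (suc n) = trans (cong ((f 0 ∧ g (suc (suc n))) xor_) (⊛-suc′ (tail f) g n))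
      (xor-leftComm (f 0 ∧ g (suc (suc n))) (f (suc (suc n)) ∧ g 0) _)

    ⊛-comm-at : ∀ f g n → (f ⊛ g) n ≡ (g ⊛ f) n
    ⊛-comm-at f g zero    = 𝔹.∧-comm (f 0) (g 0)
    ⊛-comm-at f g (suc n) = trans (cong₂ _xor_ (𝔹.∧-comm (f 0) (g (suc n))) (⊛-comm-at (tail f) g n))
      (sym (⊛-suc′ g f n))

    ⊛-assoc-at : ∀ f g h n → ((f ⊛ g) ⊛ h) n ≡ (f ⊛ (g ⊛ h)) n
    ⊛-assoc-at f g h zero    = 𝔹.∧-assoc (f 0) (g 0) (h 0)
    ⊛-assoc-at f g h (suc n) = let open ≡-Reasoning in begin
      -- The tail of `f ⊛ g` is written as a sum of two series, so that distributivity applies to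
      -- its product with `h`.
      ((f 0 ∧ g 0) ∧ h (suc n)) xor ((scale (f 0) (tail g) ⊕ (tail f ⊛ g)) ⊛ h) n
        ≡⟨ cong₂ _xor_ (𝔹.∧-assoc (f 0) (g 0) (h (suc n))) (⊛-distribʳ-at h (scale (f 0) (tail g)) (tail f ⊛ g) n) ⟩
      (f 0 ∧ (g 0 ∧ h (suc n))) xor ((scale (f 0) (tail g) ⊛ h) n xor ((tail f ⊛ g) ⊛ h) n)
        ≡⟨ 𝔹.xor-assoc (f 0 ∧ (g 0 ∧ h (suc n))) _ _ ⟨
      ((f 0 ∧ (g 0 ∧ h (suc n))) xor (scale (f 0) (tail g) ⊛ h) n) xor ((tail f ⊛ g) ⊛ h) n
        ≡⟨ cong₂ (λ u v → ((f 0 ∧ (g 0 ∧ h (suc n))) xor u) xor v)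
             (scale-⊛ (f 0) (tail g) h n) (⊛-assoc-at (tail f) g h n) ⟩
      ((f 0 ∧ (g 0 ∧ h (suc n))) xor (f 0 ∧ (tail g ⊛ h) n)) xor (tail f ⊛ (g ⊛ h)) n
        ≡⟨ cong (_xor (tail f ⊛ (g ⊛ h)) n) (𝔹.∧-distribˡ-xor (f 0) (g 0 ∧ h (suc n)) ((tail g ⊛ h) n)) ⟨
      (f 0 ∧ (g ⊛ h) (suc n)) xor (tail f ⊛ (g ⊛ h)) n ∎

  series : ℕ → CommutativeSemiring 0ℓ 0ℓ
  series L = record
    { Carrier = Series
    ; _≈_ = _≈[ L ]_
    ; _+_ = _⊕_
    ; _*_ = _⊛_
    ; 0#  = 𝟘
    ; 1#  = 𝟙
    ; isCommutativeSemiring = isCommutativeSemiringˡ record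
      { +-isCommutativeMonoid = isCommutativeMonoidˡ record
        { isSemigroup = record
          { isMagma = record { isEquivalence = equiv ; ∙-cong = ⊕-cong }
          ; assoc = λ f g h → everywhere λ n → trans (⊕-at _ _ n) (trans (cong (_xor h n) (⊕-at f g n))
              (trans (𝔹.xor-assoc (f n) (g n) (h n)) (sym (trans (⊕-at _ _ n) (cong (f n xor_) (⊕-at g h n))))))
          }
        ; identityˡ = λ f → everywhere λ n → ⊕-at 𝟘 f n
        ; comm = λ f g → everywhere λ n → trans (⊕-at f g n) (trans (𝔹.xor-comm (f n) (g n)) (sym (⊕-at g f n)))
        }
      ; *-isCommutativeMonoid = isCommutativeMonoidˡ record
        { isSemigroup = record
          { isMagma = record { isEquivalence = equiv ; ∙-cong = ⊛-cong }
          ; assoc = λ f g h → everywhere (⊛-assoc-at f g h)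
          }
        ; identityˡ = λ f → everywhere (const-⊛ true f)
        ; comm = λ f g → everywhere (⊛-comm-at f g)
        }
      ; distribʳ = λ f g h → everywhere λ n → trans (⊛-distribʳ-at f g h n) (sym (⊕-at _ _ n))
      ; zeroˡ = λ f → everywhere (𝟘-⊛ f)
      }
    }
    where
    equiv : IsEquivalence (_≈[ L ]_)
    equiv = record { refl = ≈-refl ; sym = ≈-sym ; trans = ≈-trans }

  module Mod (L : ℕ) where

    open CommutativeSemiring (series L) public
      using (setoid; +-cong; +-assoc; +-comm; +-identityˡ; +-identityʳ; *-identityˡ; *-identityʳ;
             *-assoc; *-comm; distribˡ; distribʳ; zeroˡ; zeroʳ; semiring; *-cong; *-congˡ; *-congʳ; +-congˡ; +-congʳ)
    open import Algebra.Properties.Semiring.Exp semiring public using (_^_; ^-congˡ)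
    open import Relation.Binary.Reasoning.Setoid setoid public

    -- Coefficients in F₂ make the solver cancel equal terms in pairs.
    bits : RawRing 0ℓ 0ℓ
    bits = record { Carrier = Bool ; _≈_ = _≡_ ; _+_ = _xor_ ; _*_ = _∧_ ; -_ = id ; 0# = false ; 1# = true }

    target = ACR.fromCommutativeSemiring (series L)

    embed : bits ACR.-Raw-AlmostCommutative⟶ target
    embed = record
      { ⟦_⟧ = const
      ; +-homo = λ { b c → everywhere λ { zero → sym (⊕-at _ _ 0) ; (suc n) → sym (⊕-at _ _ (suc n)) } }
      ; *-homo = λ { b c → everywhere λ { zero → sym (const-⊛ b (const c) 0)
                                        ; (suc n) → sym (trans (const-⊛ b (const c) (suc n)) (𝔹.∧-zeroʳ b)) } }
      ; -‿homo = λ _ → ≈-refl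
      ; 0-homo = everywhere λ { zero → refl ; (suc n) → refl }
      ; 1-homo = ≈-refl
      }

    _≟ᵇ_ : ∀ b c → Maybe (const b ≈[ L ] const c)
    true  ≟ᵇ true  = just ≈-refl
    false ≟ᵇ false = just ≈-refl
    _     ≟ᵇ _     = nothing

    module Solver = Algebra.Solver.Ring bits target embed _≟ᵇ_
    open Solver public using (solve; _:=_; _:+_; _:*_; _:^_; con)

  -- Monomials, finite sums, dilations and sections

  pointwise : ∀ {f g} → (∀ L → f ≈[ L ] g) → ∀ n → f n ≡ g n
  pointwise e n = at (e (suc n)) n ℕ.≤-refl

  ⊕-self : ∀ {f L} → f ⊕ f ≈[ L ] 𝟘
  ⊕-self {f} = everywhere λ n → trans (⊕-at f f n) (𝔹.xor-same (f n))

  mono : ℕ → Series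
  mono e n = e ≡ᵇ n

  mono-0 : ∀ {L} → mono 0 ≈[ L ] 𝟙
  mono-0 = everywhere λ { zero → refl ; (suc n) → refl }

  mono-⊛-low : ∀ e f n → n < e → (mono e ⊛ f) n ≡ false
  mono-⊛-low (suc e) f zero    _       = ⊛-zero _ _
  mono-⊛-low (suc e) f (suc n) (s≤s l) = trans (⊛-suc _ _ n) (mono-⊛-low e f n l)

  mono-vanish : ∀ {L e} → L ≤ e → mono e ≈[ L ] 𝟘
  mono-vanish {e = e} l = mk λ n n<L → lemma e n (ℕ.<-≤-trans n<L l)
    where
    lemma : ∀ e n → n < e → mono e n ≡ false
    lemma (suc e) zero    _       = refl
    lemma (suc e) (suc n) (s≤s l) = lemma e n l

  mono-+ : ∀ {L} a b → mono (a + b) ≈[ L ] mono a ⊛ mono b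
  mono-+ a b = everywhere (lemma a b)
    where
    lemma : ∀ a b n → mono (a + b) n ≡ (mono a ⊛ mono b) n
    lemma zero    b n       = sym (trans (⊛-cong-at n (λ { zero _ → refl ; (suc m) _ → refl }) (λ _ _ → refl))
                                         (const-⊛ true (mono b) n))
    lemma (suc a) b zero    = sym (⊛-zero _ _)
    lemma (suc a) b (suc n) = trans (lemma a b n) (sym (⊛-suc _ _ n))

  mono-≡ : ∀ {L a b} → a ≡ b → mono a ≈[ L ] mono b
  mono-≡ refl = ≈-refl

  Σ< : ℕ → (ℕ → Series) → Series
  Σ< zero    f = 𝟘
  Σ< (suc n) f = Σ< n f ⊕ f n

  module _ {L : ℕ} where
    open Mod L

    Σ-cong : ∀ n {f g : ℕ → Series} → (∀ k → k < n → f k ≈[ L ] g k) → Σ< n f ≈[ L ] Σ< n g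
    Σ-cong zero    e = ≈-refl
    Σ-cong (suc n) e = +-cong (Σ-cong n λ k l → e k (ℕ.m≤n⇒m≤1+n l)) (e n ℕ.≤-refl)

    Σ-⊕ : ∀ n f g → Σ< n (λ k → f k ⊕ g k) ≈[ L ] Σ< n f ⊕ Σ< n g
    Σ-⊕ zero    f g = ≈-sym (+-identityˡ 𝟘)
    Σ-⊕ (suc n) f g = ≈-trans (+-congʳ (Σ-⊕ n f g))
      (solve 4 (λ a b c d → (a :+ b) :+ (c :+ d) := (a :+ c) :+ (b :+ d)) ≈-refl (Σ< n f) (Σ< n g) (f n) (g n))

    ⊛-Σ : ∀ n c f → c ⊛ Σ< n f ≈[ L ] Σ< n (λ k → c ⊛ f k)
    ⊛-Σ zero    c f = zeroʳ c
    ⊛-Σ (suc n) c f = ≈-trans (distribˡ c _ _) (+-congʳ (⊛-Σ n c f))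

    Σ-front : ∀ n f → Σ< (suc n) f ≈[ L ] f 0 ⊕ Σ< n (λ k → f (suc k))
    Σ-front zero    f = +-comm 𝟘 (f 0)
    Σ-front (suc n) f = ≈-trans (+-congʳ (Σ-front n f)) (+-assoc _ _ _)

    Σ-square : ∀ n f → Σ< n f ⊛ Σ< n f ≈[ L ] Σ< n (λ k → f k ⊛ f k)
    Σ-square zero    f = zeroˡ 𝟘
    Σ-square (suc n) f = ≈-trans
      (solve 2 (λ a b → (a :+ b) :* (a :+ b) := a :* a :+ b :* b) ≈-refl (Σ< n f) (f n))
      (+-congʳ (Σ-square n f))

    Σ-stable : ∀ {m} n f → m ≤ n → (∀ k → m ≤ k → f k ≈[ L ] 𝟘) → Σ< n f ≈[ L ] Σ< m f
    Σ-stable n f m≤n z with ℕ.m≤n⇒m<n∨m≡n m≤n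
    Σ-stable n f m≤n z | inj₂ refl = ≈-refl
    Σ-stable (suc n) f m≤n z | inj₁ (s≤s m≤n′) =
      ≈-trans (+-congˡ (z n m≤n′)) (≈-trans (+-identityʳ _) (Σ-stable n f m≤n′ z))

    -- Off-diagonal terms cancel in pairs.
    Σ-symmetric : ∀ n (f : ℕ → ℕ → Series) → (∀ i j → f i j ≈[ L ] f j i) →
                  Σ< n (λ i → Σ< n (f i)) ≈[ L ] Σ< n (λ i → f i i)
    Σ-symmetric zero    f s = ≈-refl
    Σ-symmetric (suc n) f s = begin
      Σ< n (λ i → Σ< n (f i) ⊕ f i n) ⊕ (Σ< n (f n) ⊕ f n n)
        ≈⟨ +-congʳ (Σ-⊕ n (λ i → Σ< n (f i)) (λ i → f i n)) ⟩
      Σ< n (λ i → Σ< n (f i)) ⊕ Σ< n (λ i → f i n) ⊕ (Σ< n (f n) ⊕ f n n)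
        ≈⟨ +-congʳ (+-congˡ (Σ-cong n λ k _ → s k n)) ⟩
      Σ< n (λ i → Σ< n (f i)) ⊕ Σ< n (f n) ⊕ (Σ< n (f n) ⊕ f n n)
        ≈⟨ solve 3 (λ a b c → (a :+ b) :+ (b :+ c) := a :+ c) ≈-refl _ (Σ< n (f n)) (f n n) ⟩
      Σ< n (λ i → Σ< n (f i)) ⊕ f n n
        ≈⟨ +-congʳ (Σ-symmetric n f s) ⟩
      Σ< n (λ i → f i i) ⊕ f n n ∎

  -- This is X^j · f(X^(k+1)): the second argument counts the zeros still to be emitted before the
  -- next coefficient of `f`.
  gap : ℕ → ℕ → Series → Series
  gap k zero    f zero    = f 0
  gap k zero    f (suc n) = gap k k (tail f) n
  gap k (suc j) f zero    = false
  gap k (suc j) f (suc n) = gap k j f n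

  -- dilate k f = f(X^(k+1)).
  dilate : ℕ → Series → Series
  dilate k = gap k 0

  gap-cong : ∀ k j {f g} n → (∀ m → m ≤ n → f m ≡ g m) → gap k j f n ≡ gap k j g n
  gap-cong k zero    zero    e = e 0 z≤n
  gap-cong k zero    (suc n) e = gap-cong k k n λ m l → e (suc m) (s≤s l)
  gap-cong k (suc j) zero    e = refl
  gap-cong k (suc j) (suc n) e = gap-cong k j n λ m l → e m (ℕ.m≤n⇒m≤1+n l)

  dilate-cong : ∀ k {f g L} → f ≈[ L ] g → dilate k f ≈[ L ] dilate k g
  dilate-cong k e = mk λ n l → gap-cong k 0 n λ m m≤n → at e m (ℕ.≤-<-trans m≤n l)

  -- The scalar `b` matches the shape of `⊛-suc`, with `f 0` in its place; additivity is the case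
  -- `b = true`.
  gap-linear : ∀ k j b f g n → gap k j (λ m → (b ∧ f m) xor g m) n ≡ (b ∧ gap k j f n) xor gap k j g n
  gap-linear k zero    b f g zero    = refl
  gap-linear k zero    b f g (suc n) = gap-linear k k b (tail f) (tail g) n
  gap-linear k (suc j) b f g zero    = sym (cong (_xor false) (𝔹.∧-zeroʳ b))
  gap-linear k (suc j) b f g (suc n) = gap-linear k j b f g n

  gap-⊛ : ∀ k j f g n → gap k j (f ⊛ g) n ≡ (gap k j f ⊛ dilate k g) n
  gap-⊛ k zero    f g zero    = trans (⊛-zero f g) (sym (⊛-zero _ _))
  gap-⊛ k zero    f g (suc n) = begin
    gap k k (tail (f ⊛ g)) n
      ≡⟨ gap-cong k k n (λ m _ → ⊛-suc f g m) ⟩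
    gap k k (λ m → (f 0 ∧ tail g m) xor (tail f ⊛ g) m) n
      ≡⟨ gap-linear k k (f 0) (tail g) (tail f ⊛ g) n ⟩
    (f 0 ∧ gap k k (tail g) n) xor gap k k (tail f ⊛ g) n
      ≡⟨ cong ((f 0 ∧ gap k k (tail g) n) xor_) (gap-⊛ k k (tail f) g n) ⟩
    (f 0 ∧ gap k k (tail g) n) xor (gap k k (tail f) ⊛ dilate k g) n
      ≡⟨ ⊛-suc (dilate k f) (dilate k g) n ⟨
    (dilate k f ⊛ dilate k g) (suc n) ∎
    where open ≡-Reasoning
  gap-⊛ k (suc j) f g zero    = sym (⊛-zero _ _)
  gap-⊛ k (suc j) f g (suc n) = trans (gap-⊛ k j f g n) (sym (⊛-suc _ _ n))

  dilate-⊛ : ∀ k f g {L} → dilate k (f ⊛ g) ≈[ L ] dilate k f ⊛ dilate k g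
  dilate-⊛ k f g = everywhere (gap-⊛ k 0 f g)

  dilate-⊕ : ∀ k f g {L} → dilate k (f ⊕ g) ≈[ L ] dilate k f ⊕ dilate k g
  dilate-⊕ k f g = everywhere λ n → trans (gap-cong k 0 n λ m _ → ⊕-at f g m)
    (trans (gap-linear k 0 true f g n) (sym (⊕-at _ _ n)))

  gap-𝟘 : ∀ k j n → gap k j 𝟘 n ≡ false
  gap-𝟘 k zero    zero    = refl
  gap-𝟘 k zero    (suc n) = gap-𝟘 k k n
  gap-𝟘 k (suc j) zero    = refl
  gap-𝟘 k (suc j) (suc n) = gap-𝟘 k j n

  dilate-mono : ∀ k e {L} → dilate k (mono e) ≈[ L ] mono (e * suc k)
  dilate-mono k e = everywhere (lemma 0 e)
    where
    lemma : ∀ j e n → gap k j (mono e) n ≡ mono (j + e * suc k) n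
    lemma zero    zero    zero    = refl
    lemma zero    zero    (suc n) = gap-𝟘 k k n
    lemma zero    (suc e) zero    = refl
    lemma zero    (suc e) (suc n) = lemma k e n
    lemma (suc j) e       zero    = refl
    lemma (suc j) e       (suc n) = lemma j e n

  dilate-Σ : ∀ k n f {L} → dilate k (Σ< n f) ≈[ L ] Σ< n (λ i → dilate k (f i))
  dilate-Σ k zero    f = everywhere (gap-𝟘 k 0)
  dilate-Σ k (suc n) f = ≈-trans (dilate-⊕ k _ _) (⊕-cong (dilate-Σ k n f) ≈-refl)

  -- Splitting the constant term off both factors produces the cross term f 0 · f (n+2) twice, and
  -- the two copies cancel. What remains is the square of the tail, two places further on.
  frobenius : ∀ f {L} → f ⊛ f ≈[ L ] dilate 1 f
  frobenius f = everywhere (lemma f)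
    where
    lemma : ∀ f n → (f ⊛ f) n ≡ dilate 1 f n
    lemma f zero          = trans (⊛-zero f f) (𝔹.∧-idem (f 0))
    lemma f (suc zero)    = trans (⊛-suc f f 0) (trans (cong ((f 0 ∧ f 1) xor_) (trans (⊛-zero _ f) (𝔹.∧-comm (f 1) (f 0))))
      (𝔹.xor-same (f 0 ∧ f 1)))
    lemma f (suc (suc n)) = begin
      (f ⊛ f) (suc (suc n))
        ≡⟨ ⊛-suc f f (suc n) ⟩
      (f 0 ∧ f (suc (suc n))) xor (tail f ⊛ f) (suc n)
        ≡⟨ cong₂ _xor_ (𝔹.∧-comm (f 0) _) (⊛-suc′ (tail f) f n) ⟩
      (f (suc (suc n)) ∧ f 0) xor ((f (suc (suc n)) ∧ f 0) xor (tail f ⊛ tail f) n)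
        ≡⟨ 𝔹.xor-assoc (f (suc (suc n)) ∧ f 0) _ _ ⟨
      ((f (suc (suc n)) ∧ f 0) xor (f (suc (suc n)) ∧ f 0)) xor (tail f ⊛ tail f) n
        ≡⟨ cong (_xor (tail f ⊛ tail f) n) (𝔹.xor-same (f (suc (suc n)) ∧ f 0)) ⟩
      (tail f ⊛ tail f) n
        ≡⟨ lemma (tail f) n ⟩
      dilate 1 (tail f) n ∎
      where open ≡-Reasoning

  -- Extraction of coefficients along arithmetic progressions

  progression : ℕ → ℕ → ℕ → ℕ
  progression k r zero    = r
  progression k r (suc n) = suc (k + progression k r n)

  progression≡ : ∀ k r n → progression k r n ≡ n * suc k + r
  progression≡ k r zero    = refl
  progression≡ k r (suc n) = cong suc (trans (cong (k +_) (progression≡ k r n)) (sym (ℕ.+-assoc k _ r)))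

  -- The coefficients of index ≡ r modulo k+1.
  section : ℕ → ℕ → Series → Series
  section k r f n = f (progression k r n)

  -- Coefficient n of a section lies near index (k+1)n of the series, beyond the precision of the
  -- conclusion; hence the hypothesis is required for every L.
  section-cong : ∀ k r {f g} → (∀ L → f ≈[ L ] g) → ∀ L → section k r f ≈[ L ] section k r g
  section-cong k r e L = everywhere λ n → pointwise e (progression k r n)

  section-⊕ : ∀ k r f g {L} → section k r (f ⊕ g) ≈[ L ] section k r f ⊕ section k r g
  section-⊕ k r f g = everywhere λ n → trans (⊕-at f g _) (sym (⊕-at _ _ n))

  -- A series in X^(k+1) only moves indices by multiples of k+1 and so passes through the section.
  -- The bound r ≤ k ensures that at index r only the constant term of `f` contributes.
  section-dilate-⊛ : ∀ k r → r ≤ k → ∀ f g {L} → section k r (dilate k f ⊛ g) ≈[ L ] f ⊛ section k r g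
  section-dilate-⊛ k r r≤k f g = everywhere (lemma f)
    where
    low : ∀ j f n → n < j → (gap k j f ⊛ g) n ≡ false
    low (suc j) f zero    _       = ⊛-zero _ _
    low (suc j) f (suc n) (s≤s l) = trans (⊛-suc _ _ n) (low j f n l)

    skip : ∀ j f n → (gap k j f ⊛ g) (j + n) ≡ (dilate k f ⊛ g) n
    skip zero    f n = refl
    skip (suc j) f n = trans (⊛-suc _ _ (j + n)) (skip j f n)

    start : ∀ r → r ≤ k → ∀ f → (dilate k f ⊛ g) r ≡ f 0 ∧ g r
    start zero    l f = ⊛-zero _ _
    start (suc r) l f = trans (⊛-suc _ _ r) (trans (cong ((f 0 ∧ g (suc r)) xor_) (low k (tail f) r l))
      (𝔹.xor-identityʳ _))

    lemma : ∀ f n → (dilate k f ⊛ g) (progression k r n) ≡ (f ⊛ section k r g) n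
    lemma f zero    = trans (start r r≤k f) (sym (⊛-zero _ _))
    lemma f (suc n) = trans (⊛-suc _ _ (k + progression k r n)) (trans
      (cong ((f 0 ∧ g (progression k r (suc n))) xor_) (trans (skip k (tail f) (progression k r n)) (lemma (tail f) n)))
      (sym (⊛-suc _ _ n)))

  -- The theta series ψ and Shanks' identity

  Π< : ℕ → (ℕ → Series) → Series
  Π< zero    f = 𝟙
  Π< (suc n) f = Π< n f ⊛ f n

  module _ {L : ℕ} where
    open Mod L

    Π-cong : ∀ n {f g : ℕ → Series} → (∀ k → f k ≈[ L ] g k) → Π< n f ≈[ L ] Π< n g
    Π-cong zero    e = ≈-refl
    Π-cong (suc n) e = *-cong (Π-cong n e) (e n)

    Π-⊛ : ∀ n f g → Π< n (λ k → f k ⊛ g k) ≈[ L ] Π< n f ⊛ Π< n g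
    Π-⊛ zero    f g = ≈-sym (*-identityˡ 𝟙)
    Π-⊛ (suc n) f g = ≈-trans (*-congʳ (Π-⊛ n f g))
      (solve 4 (λ a b c d → (a :* b) :* (c :* d) := (a :* c) :* (b :* d)) ≈-refl (Π< n f) (Π< n g) (f n) (g n))

    Π-one : ∀ n {f : ℕ → Series} → (∀ k → f k ≈[ L ] 𝟙) → Π< n f ≈[ L ] 𝟙
    Π-one zero    e = ≈-refl
    Π-one (suc n) e = ≈-trans (*-cong (Π-one n e) (e n)) (*-identityˡ 𝟙)

    Π-stable : ∀ {m} n f → m ≤ n → (∀ k → m ≤ k → f k ≈[ L ] 𝟙) → Π< n f ≈[ L ] Π< m f
    Π-stable n f m≤n z with ℕ.m≤n⇒m<n∨m≡n m≤n
    Π-stable n f m≤n z | inj₂ refl = ≈-refl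
    Π-stable (suc n) f m≤n z | inj₁ (s≤s m≤n′) =
      ≈-trans (*-congˡ (z n m≤n′)) (≈-trans (*-identityʳ _) (Π-stable n f m≤n′ z))

  one+mono : ℕ → Series
  one+mono m = 𝟙 ⊕ mono m

  geometric : ℕ → Series
  geometric m n = (n % suc m) ≡ᵇ 0

  mono-⊛-shift : ∀ e f n → (mono e ⊛ f) (e + n) ≡ f n
  mono-⊛-shift zero    f n = trans (at {L = suc n} (⊛-cong mono-0 ≈-refl) n ℕ.≤-refl) (const-⊛ true f n)
  mono-⊛-shift (suc e) f n = trans (⊛-suc _ _ (e + n)) (mono-⊛-shift e f n)

  geometric-inverse : ∀ m {L} → one+mono (suc m) ⊛ geometric m ≈[ L ] 𝟙
  geometric-inverse m {L} = ≈-trans (distribʳ _ _ _) (≈-trans (+-congʳ (*-identityˡ _)) (everywhere λ n → trans (⊕-at _ _ n) (lemma n)))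
    where
    open Mod L
    lemma : ∀ n → geometric m n xor (mono (suc m) ⊛ geometric m) n ≡ 𝟙 n
    lemma n with n <? suc m
    ... | yes n<m = trans (cong₂ _xor_ (cong (_≡ᵇ 0) (m<n⇒m%n≡m n<m)) (mono-⊛-low (suc m) _ n n<m))
                      (trans (𝔹.xor-identityʳ _) (≡ᵇ0 n))
      where
      ≡ᵇ0 : ∀ n → (n ≡ᵇ 0) ≡ 𝟙 n
      ≡ᵇ0 zero    = refl
      ≡ᵇ0 (suc n) = refl
    ... | no n≮m = subst (λ n → geometric m n xor (mono (suc m) ⊛ geometric m) n ≡ 𝟙 n) (ℕ.m+[n∸m]≡n (ℕ.≮⇒≥ n≮m))
      (trans (cong₂ _xor_
        (cong (_≡ᵇ 0) (trans (cong (_% suc m) (ℕ.+-comm (suc m) d)) ([m+n]%n≡m%n d (suc m))))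
        (mono-⊛-shift (suc m) (geometric m) d)) (𝔹.xor-same (geometric m d)))
      where d = n ∸ suc m

  -- Triangular numbers and the series ψ

  T : ℕ → ℕ
  T zero    = 0
  T (suc n) = suc n + T n

  n≤T : ∀ n → n ≤ T n
  n≤T zero    = z≤n
  n≤T (suc n) = ℕ.m≤m+n (suc n) (T n)

  T-double : ∀ n → T n + T n ≡ n * suc n
  T-double zero    = refl
  T-double (suc n) = trans (regroup n (T n)) (trans (cong (λ t → suc n + suc n + t) (T-double n)) (expand n))
    where
    regroup : ∀ n t → suc n + t + (suc n + t) ≡ suc n + suc n + (t + t)
    regroup = solve-∀
    expand : ∀ n → suc n + suc n + n * suc n ≡ suc n * suc (suc n)
    expand = solve-∀

  -- Since k ≤ T k, the terms with k > n cannot reach coefficient n, so a finite sum depending on n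
  -- suffices.
  ψ : Series
  ψ n = Σ< (suc n) (λ k → mono (T k)) n

  ψ≈Σ : ∀ L → ψ ≈[ L ] Σ< L (λ k → mono (T k))
  ψ≈Σ L = mk λ n n<L → sym (at (Σ-stable {L = suc n} L (λ k → mono (T k)) n<L
    λ k n<k → mono-vanish (ℕ.≤-trans n<k (n≤T k))) n ℕ.≤-refl)

  -- Identities between triangular numbers are proved after doubling, where `T-double` turns them
  -- into polynomial identities without division.
  double-cancel : ∀ {a b} → a + a ≡ b + b → a ≡ b
  double-cancel {a} {b} e = ℕ.*-cancelˡ-≡ a b 2 (trans (dbl a) (trans e (sym (dbl b))))
    where
    dbl : ∀ a → 2 * a ≡ a + a
    dbl = solve-∀

  T-even : ∀ n → T (n * 2) ≡ n * suc (n * 2)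
  T-even n = double-cancel (trans (T-double (n * 2)) (lemma n))
    where
    lemma : ∀ n → n * 2 * suc (n * 2) ≡ n * suc (n * 2) + n * suc (n * 2)
    lemma = solve-∀

  -- Finite Euler products and Shanks' identity

  odds evens evens⁻¹ euler euler⁻¹ : ℕ → Series
  odds    n = Π< n λ i → one+mono (suc (i * 2))
  evens   n = Π< n λ i → one+mono (suc (suc (i * 2)))
  evens⁻¹ n = Π< n λ i → geometric (suc (i * 2))
  euler     n = Π< n λ i → one+mono (suc i)
  euler⁻¹   n = Π< n λ i → geometric i

  euler-inverse : ∀ n {L} → euler n ⊛ euler⁻¹ n ≈[ L ] 𝟙
  euler-inverse n = ≈-trans (≈-sym (Π-⊛ n _ _)) (Π-one n λ i → geometric-inverse i)

  evens-inverse : ∀ n {L} → evens n ⊛ evens⁻¹ n ≈[ L ] 𝟙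
  evens-inverse n = ≈-trans (≈-sym (Π-⊛ n _ _)) (Π-one n λ i → geometric-inverse (suc (i * 2)))

  -- 1/P_s for P_s = ∏_{t≤s} (1 − X^{2t})/(1 − X^{2t−1}), in the notation of Shanks' identity
  -- Σ_{s<n} (P_n/P_s) X^{s(2n+1)} = Σ_{k<2n} X^{k(k+1)/2}.
  ratio : ℕ → Series
  ratio s = odds s ⊛ evens⁻¹ s

  shanks-sum : ℕ → ℕ → Series
  shanks-sum c r = Σ< r λ s → ratio s ⊛ mono (s * c)

  module _ {L : ℕ} where
    open Mod L

    ratio-suc : ∀ s → ratio (suc s) ⊛ one+mono (suc (suc (s * 2))) ≈[ L ] ratio s ⊛ one+mono (suc (s * 2))
    ratio-suc s = begin
      odds s ⊛ a ⊛ (evens⁻¹ s ⊛ b⁻¹) ⊛ b   ≈⟨ solve 5 (λ o a e b′ b → o :* a :* (e :* b′) :* b := o :* e :* a :* (b :* b′)) ≈-refl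
                                                (odds s) a (evens⁻¹ s) b⁻¹ b ⟩
      odds s ⊛ evens⁻¹ s ⊛ a ⊛ (b ⊛ b⁻¹)   ≈⟨ *-congˡ (geometric-inverse (suc (s * 2))) ⟩
      odds s ⊛ evens⁻¹ s ⊛ a ⊛ 𝟙           ≈⟨ *-identityʳ _ ⟩
      ratio s ⊛ a                          ∎
      where
      a b b⁻¹ : Series
      a   = one+mono (suc (s * 2))
      b   = one+mono (suc (suc (s * 2)))
      b⁻¹ = geometric (suc (s * 2))

    evens-ratio : ∀ n → evens n ⊛ ratio n ≈[ L ] odds n
    evens-ratio n = begin
      evens n ⊛ (odds n ⊛ evens⁻¹ n)   ≈⟨ solve 3 (λ e o e′ → e :* (o :* e′) := o :* (e :* e′)) ≈-refl (evens n) (odds n) (evens⁻¹ n) ⟩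
      odds n ⊛ (evens n ⊛ evens⁻¹ n)   ≈⟨ *-congˡ (evens-inverse n) ⟩
      odds n ⊛ 𝟙                       ≈⟨ *-identityʳ _ ⟩
      odds n                           ∎

    mono-*-2+ : ∀ s c → mono (s * suc (suc c)) ≈[ L ] mono (s * c) ⊛ mono (s * 2)
    mono-*-2+ s c = ≈-trans (mono-≡ (lemma s c)) (mono-+ (s * c) (s * 2))
      where
      lemma : ∀ s c → s * suc (suc c) ≡ s * c + s * 2
      lemma = solve-∀

    -- With G r the right-hand side, `ratio-suc` shows that G (r+1) - G r is the s = r term of the
    -- left-hand side. The induction on n in `shanks` uses c = 2n+1, for which the factors 1 +
    -- X^(c+1) and 1 + X^c are the new factors of `evens` and `odds`.
    telescope : ∀ c r → one+mono (suc c) ⊛ shanks-sum (suc (suc c)) r ⊕ one+mono c ⊛ shanks-sum c r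
                        ≈[ L ] ratio r ⊛ one+mono (r * 2) ⊛ mono (r * c)
    telescope c zero = begin
      one+mono (suc c) ⊛ 𝟘 ⊕ one+mono c ⊛ 𝟘   ≈⟨ +-cong (zeroʳ _) (zeroʳ _) ⟩
      𝟘 ⊕ 𝟘                                   ≈⟨ +-identityˡ 𝟘 ⟩
      𝟘                                       ≈⟨ ≈-trans (*-congʳ (zeroʳ _)) (zeroˡ _) ⟨
      ratio 0 ⊛ 𝟘 ⊛ mono 0                    ≈⟨ *-congʳ (*-congˡ ⊕-self) ⟨
      ratio 0 ⊛ (𝟙 ⊕ 𝟙) ⊛ mono 0              ≈⟨ *-congʳ (*-congˡ (+-congˡ mono-0)) ⟨
      ratio 0 ⊛ one+mono 0 ⊛ mono 0           ∎
    telescope c (suc r) = begin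
      one+mono (suc c) ⊛ (U ⊕ h ⊛ mono (r * suc (suc c))) ⊕ (𝟙 ⊕ q) ⊛ (V ⊕ h ⊛ A)
        ≈⟨ +-congʳ (*-cong (+-congˡ (mono-+ 1 c)) (+-congˡ (*-congˡ (mono-*-2+ r c)))) ⟩
      (𝟙 ⊕ x ⊛ q) ⊛ (U ⊕ h ⊛ (A ⊛ p)) ⊕ (𝟙 ⊕ q) ⊛ (V ⊕ h ⊛ A)
        ≈⟨ solve 7 (λ x q U h A p V →
             (con true :+ x :* q) :* (U :+ h :* (A :* p)) :+ (con true :+ q) :* (V :+ h :* A) :=
             ((con true :+ x :* q) :* U :+ (con true :+ q) :* V) :+ h :* A :* ((con true :+ x :* q) :* p :+ (con true :+ q)))
             ≈-refl x q U h A p V ⟩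
      ((𝟙 ⊕ x ⊛ q) ⊛ U ⊕ (𝟙 ⊕ q) ⊛ V) ⊕ h ⊛ A ⊛ ((𝟙 ⊕ x ⊛ q) ⊛ p ⊕ (𝟙 ⊕ q))
        ≈⟨ +-congʳ (+-congʳ (*-congʳ (+-congˡ (mono-+ 1 c)))) ⟨
      (one+mono (suc c) ⊛ U ⊕ (𝟙 ⊕ q) ⊛ V) ⊕ h ⊛ A ⊛ ((𝟙 ⊕ x ⊛ q) ⊛ p ⊕ (𝟙 ⊕ q))
        ≈⟨ +-congʳ (telescope c r) ⟩
      h ⊛ (𝟙 ⊕ p) ⊛ A ⊕ h ⊛ A ⊛ ((𝟙 ⊕ x ⊛ q) ⊛ p ⊕ (𝟙 ⊕ q))
        ≈⟨ solve 5 (λ x q h A p →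
             h :* (con true :+ p) :* A :+ h :* A :* ((con true :+ x :* q) :* p :+ (con true :+ q)) :=
             h :* (con true :+ x :* p) :* (q :* A)) ≈-refl x q h A p ⟩
      h ⊛ (𝟙 ⊕ x ⊛ p) ⊛ (q ⊛ A)
        ≈⟨ *-cong (*-congˡ (+-congˡ (mono-+ 1 (r * 2)))) (mono-+ c (r * c)) ⟨
      h ⊛ one+mono (suc (r * 2)) ⊛ mono (suc r * c)
        ≈⟨ *-congʳ (ratio-suc r) ⟨
      ratio (suc r) ⊛ one+mono (suc r * 2) ⊛ mono (suc r * c) ∎
      where
      x q p A h U V : Series
      x = mono 1
      q = mono c
      p = mono (r * 2)
      A = mono (r * c)
      h = ratio r
      U = shanks-sum (suc (suc c)) r
      V = shanks-sum c r

    shanks : ∀ n → evens n ⊛ shanks-sum (suc (n * 2)) n ≈[ L ] odds n ⊛ Σ< (n * 2) (λ k → mono (T k))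
    shanks zero    = ≈-trans (zeroʳ _) (≈-sym (zeroʳ _))
    shanks (suc n) = begin
      e ⊛ one+mono (suc c) ⊛ (U ⊕ h ⊛ mono (n * suc (suc c)))
        ≈⟨ *-cong (*-congˡ (+-congˡ (mono-+ 1 c))) (+-congˡ (*-congˡ (mono-*-2+ n c))) ⟩
      e ⊛ (𝟙 ⊕ x ⊛ q) ⊛ (U ⊕ h ⊛ (A ⊛ p))
        -- The product (1 + q)·e·V is inserted twice, which changes nothing modulo 2: one copy
        -- completes the left-hand side of `telescope`, the other is rewritten by the induction
        -- hypothesis.
        ≈⟨ solve 8 (λ e x q U h A p V →
             e :* (con true :+ x :* q) :* (U :+ h :* (A :* p)) :=
             e :* ((con true :+ x :* q) :* U :+ (con true :+ q) :* V) :+ (con true :+ q) :* (e :* V)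
               :+ (con true :+ x :* q) :* A :* p :* (e :* h)) ≈-refl e x q U h A p V ⟩
      e ⊛ ((𝟙 ⊕ x ⊛ q) ⊛ U ⊕ (𝟙 ⊕ q) ⊛ V) ⊕ (𝟙 ⊕ q) ⊛ (e ⊛ V) ⊕ (𝟙 ⊕ x ⊛ q) ⊛ A ⊛ p ⊛ (e ⊛ h)
        ≈⟨ +-cong (+-cong (*-congˡ (≈-trans (+-congʳ (*-congʳ (+-congˡ (≈-sym (mono-+ 1 c))))) (telescope c n)))
                          (*-congˡ (shanks n)))
                  (*-congˡ (evens-ratio n)) ⟩
      e ⊛ (h ⊛ (𝟙 ⊕ p) ⊛ A) ⊕ (𝟙 ⊕ q) ⊛ (o ⊛ S) ⊕ (𝟙 ⊕ x ⊛ q) ⊛ A ⊛ p ⊛ o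
        ≈⟨ +-congʳ (+-congʳ (≈-trans
             (solve 4 (λ e h p A → e :* (h :* (con true :+ p) :* A) := e :* h :* ((con true :+ p) :* A)) ≈-refl e h p A)
             (*-congʳ (evens-ratio n)))) ⟩
      o ⊛ ((𝟙 ⊕ p) ⊛ A) ⊕ (𝟙 ⊕ q) ⊛ (o ⊛ S) ⊕ (𝟙 ⊕ x ⊛ q) ⊛ A ⊛ p ⊛ o
        ≈⟨ solve 6 (λ o p A q x S →
             o :* ((con true :+ p) :* A) :+ (con true :+ q) :* (o :* S) :+ (con true :+ x :* q) :* A :* p :* o :=
             o :* A :+ (con true :+ q) :* (o :* S) :+ o :* A :* q :* (x :* p)) ≈-refl o p A q x S ⟩
      o ⊛ A ⊕ (𝟙 ⊕ q) ⊛ (o ⊛ S) ⊕ o ⊛ A ⊛ q ⊛ (x ⊛ p)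
        ≈⟨ +-congˡ (*-congˡ (mono-+ 1 (n * 2))) ⟨
      o ⊛ A ⊕ (𝟙 ⊕ q) ⊛ (o ⊛ S) ⊕ o ⊛ A ⊛ q ⊛ q
        ≈⟨ solve 4 (λ o A q S →
             o :* A :+ (con true :+ q) :* (o :* S) :+ o :* A :* q :* q :=
             o :* (con true :+ q) :* (S :+ A :+ q :* A)) ≈-refl o A q S ⟩
      o ⊛ (𝟙 ⊕ q) ⊛ (S ⊕ A ⊕ q ⊛ A)
        -- The two new terms are A = X^T(2n) and q·A = X^T(2n+1), as T(2n) = n(2n+1).
        ≈⟨ *-congˡ (+-cong (+-congˡ (mono-≡ (T-even n)))
             (≈-trans (mono-+ c (T (n * 2))) (*-congˡ (mono-≡ (T-even n))))) ⟨
      odds (suc n) ⊛ Σ< (suc n * 2) (λ k → mono (T k)) ∎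
      where
      c : ℕ
      c = suc (n * 2)
      x q p A h U V e o S : Series
      x = mono 1
      q = mono c
      p = mono (n * 2)
      A = mono (n * c)
      h = ratio n
      U = shanks-sum (suc (suc c)) n
      V = shanks-sum c n
      e = evens n
      o = odds n
      S = Σ< (n * 2) (λ k → mono (T k))

    odds-evens : ∀ n → odds n ⊛ evens n ≈[ L ] euler (n * 2)
    odds-evens zero    = *-identityˡ 𝟙
    odds-evens (suc n) = ≈-trans
      (solve 4 (λ a b c d → (a :* b) :* (c :* d) := a :* c :* b :* d) ≈-refl (odds n) _ (evens n) _)
      (*-congʳ (*-congʳ (odds-evens n)))

    one+mono-square : ∀ m → one+mono (m * 2) ≈[ L ] one+mono m ⊛ one+mono m
    one+mono-square m = begin
      𝟙 ⊕ mono (m * 2)         ≈⟨ +-congˡ (mono-≡ (lemma m)) ⟩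
      𝟙 ⊕ mono (m + m)         ≈⟨ +-congˡ (mono-+ m m) ⟩
      𝟙 ⊕ mono m ⊛ mono m      ≈⟨ solve 1 (λ x → con true :+ x :* x := (con true :+ x) :* (con true :+ x)) ≈-refl (mono m) ⟩
      one+mono m ⊛ one+mono m  ∎
      where
      lemma : ∀ m → m * 2 ≡ m + m
      lemma = solve-∀

    evens-square : ∀ n → evens n ≈[ L ] euler n ⊛ euler n
    evens-square n = ≈-trans (Π-cong n λ i → one+mono-square (suc i)) (Π-⊛ n _ _)

  one+mono-vanish : ∀ {L e} → L ≤ e → one+mono e ≈[ L ] 𝟙
  one+mono-vanish {L} l = ≈-trans (+-congˡ (mono-vanish l)) (+-identityʳ 𝟙)
    where open Mod L

  shanks-sum-vanish : ∀ c n → shanks-sum c (suc n) ≈[ c ] 𝟙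
  shanks-sum-vanish c n = begin
    shanks-sum c (suc n)          ≈⟨ Σ-stable {m = 1} (suc n) (λ s → ratio s ⊛ mono (s * c)) (s≤s z≤n) vanish ⟩
    𝟘 ⊕ 𝟙 ⊛ 𝟙 ⊛ mono 0            ≈⟨ +-identityˡ _ ⟩
    𝟙 ⊛ 𝟙 ⊛ mono 0                ≈⟨ *-cong (*-identityˡ 𝟙) mono-0 ⟩
    𝟙 ⊛ 𝟙                         ≈⟨ *-identityˡ 𝟙 ⟩
    𝟙                             ∎
    where
    open Mod c
    vanish : ∀ k → 1 ≤ k → ratio k ⊛ mono (k * c) ≈[ c ] 𝟘
    vanish (suc k) _ = ≈-trans (*-congˡ (mono-vanish (ℕ.m≤m+n c (k * c)))) (zeroʳ _)

  -- From Shanks' identity to the cube of the Euler product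

  euler-stable : ∀ {n m} → n ≤ m → euler m ≈[ suc n ] euler n
  euler-stable {m = m} n≤m = Π-stable m _ n≤m λ k n≤k → one+mono-vanish (s≤s n≤k)

  n≤n*2 : ∀ n → n ≤ n * 2
  n≤n*2 n = ℕ.m≤m*n n 2

  -- Gauss' identity in truncated form: to this precision only the term s = 0 of the sum in `shanks`
  -- survives.
  evens≈odds-ψ : ∀ n → evens n ≈[ n * 2 ] odds n ⊛ ψ
  evens≈odds-ψ zero    = mk λ _ ()
  evens≈odds-ψ (suc n) = begin
    evens (suc n)                                              ≈⟨ *-identityʳ _ ⟨
    evens (suc n) ⊛ 𝟙                                          ≈⟨ *-congˡ (weaken (ℕ.n≤1+n _) (shanks-sum-vanish (suc (suc n * 2)) n)) ⟨
    evens (suc n) ⊛ shanks-sum (suc (suc n * 2)) (suc n)       ≈⟨ shanks (suc n) ⟩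
    odds (suc n) ⊛ Σ< (suc n * 2) (λ k → mono (T k))           ≈⟨ *-congˡ (ψ≈Σ (suc n * 2)) ⟨
    odds (suc n) ⊛ ψ                                           ∎
    where open Mod (suc n * 2)

  -- As `evens n` is g² modulo 2, g³ is `evens n` squared over g. Replacing one factor `evens n` by
  -- `odds n ⊛ ψ` lets the other combine with `odds n` to `euler (n * 2)`, which agrees with g to
  -- this precision and cancels.
  euler-cube-weak : ∀ n → euler n ⊛ euler n ⊛ euler n ≈[ n ] ψ
  euler-cube-weak n = begin
    g ⊛ g ⊛ g                              ≈⟨ *-identityʳ _ ⟨
    g ⊛ g ⊛ g ⊛ 𝟙                          ≈⟨ *-congˡ (euler-inverse n) ⟨
    g ⊛ g ⊛ g ⊛ (g ⊛ g⁻¹)                  ≈⟨ solve 2 (λ g i → g :* g :* g :* (g :* i) := (g :* g) :* (g :* g) :* i) ≈-refl g g⁻¹ ⟩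
    (g ⊛ g) ⊛ (g ⊛ g) ⊛ g⁻¹                ≈⟨ *-congʳ (*-cong (evens-square n) (evens-square n)) ⟨
    evens n ⊛ evens n ⊛ g⁻¹                ≈⟨ *-congʳ (*-congʳ (weaken (n≤n*2 n) (evens≈odds-ψ n))) ⟩
    odds n ⊛ ψ ⊛ evens n ⊛ g⁻¹             ≈⟨ solve 4 (λ o p e i → o :* p :* e :* i := o :* e :* p :* i) ≈-refl (odds n) ψ (evens n) g⁻¹ ⟩
    odds n ⊛ evens n ⊛ ψ ⊛ g⁻¹             ≈⟨ *-congʳ (*-congʳ (odds-evens n)) ⟩
    euler (n * 2) ⊛ ψ ⊛ g⁻¹                  ≈⟨ *-congʳ (*-congʳ (weaken (ℕ.n≤1+n n) (euler-stable (n≤n*2 n)))) ⟩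
    g ⊛ ψ ⊛ g⁻¹                            ≈⟨ solve 3 (λ g p i → g :* p :* i := p :* (g :* i)) ≈-refl g ψ g⁻¹ ⟩
    ψ ⊛ (g ⊛ g⁻¹)                          ≈⟨ *-congˡ (euler-inverse n) ⟩
    ψ ⊛ 𝟙                                  ≈⟨ *-identityʳ ψ ⟩
    ψ                                      ∎
    where
    open Mod n
    g g⁻¹ : Series
    g   = euler n
    g⁻¹ = euler⁻¹ n

  -- The factor of index n+1 is 1 modulo X^(n+1), which gains one coefficient. This is needed
  -- because `Fcoeff N` reads coefficient N off a product of only N factors.
  euler-cube : ∀ n → euler n ⊛ euler n ⊛ euler n ≈[ suc n ] ψ
  euler-cube n = ≈-trans (⊛-cong (⊛-cong e e) e) (euler-cube-weak (suc n))
    where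
    e : euler n ≈[ suc n ] euler (suc n)
    e = ≈-sym (euler-stable (ℕ.n≤1+n n))

  -- The product ψ(X)ψ(X³)

  -- T⁻ a b = T(a − b), where T(m) = m(m+1)/2 = T(−1−m) for m ∈ ℤ.
  T⁻ : ℕ → ℕ → ℕ
  T⁻ a       zero    = T a
  T⁻ zero    (suc b) = T b
  T⁻ (suc a) (suc b) = T⁻ a b

  -- This is 2T(a-b) = (a-b)² + (a-b) with the negative terms moved to the left.
  T⁻-double : ∀ a b → T⁻ a b + T⁻ a b + (a * b + a * b + b) ≡ a * a + b * b + a
  T⁻-double a zero = trans (cong (_+ (a * 0 + a * 0 + 0)) (T-double a)) (lemma a)
    where
    lemma : ∀ a → a * suc a + (a * 0 + a * 0 + 0) ≡ a * a + 0 * 0 + a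
    lemma = solve-∀
  T⁻-double zero (suc b) = trans (cong (_+ suc b) (T-double b)) (lemma b)
    where
    lemma : ∀ b → b * suc b + suc b ≡ suc b * suc b + 0
    lemma = solve-∀
  T⁻-double (suc a) (suc b) = trans (left a b (T⁻ a b)) (trans (cong (_+ (2 * a + 2 * b + 3)) (T⁻-double a b)) (right a b))
    where
    left : ∀ a b t → t + t + (suc a * suc b + suc a * suc b + suc b) ≡ t + t + (a * b + a * b + b) + (2 * a + 2 * b + 3)
    left = solve-∀
    right : ∀ a b → a * a + b * b + a + (2 * a + 2 * b + 3) ≡ suc a * suc a + suc b * suc b + suc a
    right = solve-∀

  T⁻-lower : ∀ a b → a ≤ b + T⁻ a b
  T⁻-lower a       zero    = n≤T a
  T⁻-lower zero    (suc b) = z≤n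
  T⁻-lower (suc a) (suc b) = s≤s (T⁻-lower a b)

  monoT : ℕ → Series
  monoT k = mono (T k)

  Σ-pairs : ∀ n f {L} → Σ< (n * 2) f ≈[ L ] Σ< n (λ i → f (i * 2) ⊕ f (suc (i * 2)))
  Σ-pairs zero    f = ≈-refl
  Σ-pairs (suc n) f {L} = ≈-trans (+-assoc _ _ _) (+-congʳ (Σ-pairs n f))
    where open Mod L

  -- Passage from l to l+2 in the progression 2i - l. With u i = X^T(2i-l) and v i = X^T(l+1+2i),
  -- the first family shifts up by one place, the second down by one, and v 0 changes family. The
  -- terms lost or gained at the cut-off are zero at this precision.
  Σ-reindex : ∀ B (u v u′ v′ : ℕ → Series) →
              u′ 0 ≈[ suc B ] v 0 → (∀ i → u′ (suc i) ≈[ suc B ] u i) → (∀ i → v′ i ≈[ suc B ] v (suc i)) →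
              u B ≈[ suc B ] 𝟘 → v (suc B) ≈[ suc B ] 𝟘 →
              Σ< (suc B) (λ i → u′ i ⊕ v′ i) ≈[ suc B ] Σ< (suc B) (λ i → u i ⊕ v i)
  Σ-reindex B u v u′ v′ u′0 u′s v′s uB vB = begin
    Σ< (suc B) (λ i → u′ i ⊕ v′ i)
      ≈⟨ Σ-⊕ (suc B) u′ v′ ⟩
    Σ< (suc B) u′ ⊕ Σ< (suc B) v′
      ≈⟨ +-cong (Σ-front B u′) (Σ-cong (suc B) λ i _ → v′s i) ⟩
    (u′ 0 ⊕ Σ< B (λ i → u′ (suc i))) ⊕ (Σ< B (λ i → v (suc i)) ⊕ v (suc B))
      ≈⟨ +-cong (+-cong u′0 (Σ-cong B λ i _ → u′s i)) (+-congˡ (≈-trans vB (≈-sym uB))) ⟩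
    (v 0 ⊕ Σ< B u) ⊕ (Σ< B (λ i → v (suc i)) ⊕ u B)
      ≈⟨ solve 4 (λ a b c d → (a :+ b) :+ (c :+ d) := (b :+ d) :+ (a :+ c)) ≈-refl (v 0) (Σ< B u) _ (u B) ⟩
    Σ< (suc B) u ⊕ (v 0 ⊕ Σ< B (λ i → v (suc i)))
      ≈⟨ +-congˡ (Σ-front B v) ⟨
    Σ< (suc B) u ⊕ Σ< (suc B) v
      ≈⟨ Σ-⊕ (suc B) u v ⟨
    Σ< (suc B) (λ i → u i ⊕ v i) ∎
    where open Mod (suc B)

  -- The integers congruent to l modulo 2 are 2i − l and −1 − (l + 1 + 2i) for i ≥ 0,
  -- and T takes each of its values exactly once on them.
  ψ≈progression : ∀ l B → l ≤ B →
    Σ< B (λ i → mono (T⁻ (i * 2) l) ⊕ monoT (l + suc (i * 2))) ≈[ B ] ψ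
  ψ≈progression zero B _ = ≈-trans (≈-sym (Σ-pairs B monoT))
    (≈-sym (weaken (n≤n*2 B) (ψ≈Σ (B * 2))))
  ψ≈progression (suc zero) (suc B) _ = ≈-trans
    -- These are the two families for l = -1, so l = 1 is reached from there by the same shift; up
    -- to order they are the families for l = 0.
    (Σ-reindex B (λ i → monoT (suc (i * 2))) (λ i → monoT (i * 2)) _ _
      ≈-refl (λ i → ≈-refl) (λ i → ≈-refl)
      (mono-vanish (ℕ.≤-trans (s≤s (n≤n*2 B)) (n≤T (suc (B * 2)))))
      (mono-vanish (ℕ.≤-trans (n≤n*2 (suc B)) (n≤T (suc B * 2)))))
    (≈-trans (Σ-cong (suc B) λ i _ → +-comm _ _) (ψ≈progression zero (suc B) z≤n))
    where open Mod (suc B)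
  ψ≈progression (suc (suc l)) (suc B) (s≤s l<B) = ≈-trans
    (Σ-reindex B (λ i → mono (T⁻ (i * 2) l)) (λ i → monoT (l + suc (i * 2))) _ _
      (mono-≡ (cong T (ℕ.+-comm 1 l)))
      (λ i → ≈-refl)
      (λ i → mono-≡ (cong T (sym (trans (ℕ.+-suc l _) (cong suc (ℕ.+-suc l _))))))
      -- The exponent T(2B-l) is at least 2B - l, and l < B makes this at least B + 1. This is where
      -- the number of terms has to exceed l.
      (mono-vanish (ℕ.+-cancelˡ-≤ l _ _ (ℕ.≤-trans bound (T⁻-lower (B * 2) l))))
      (mono-vanish (ℕ.≤-trans (ℕ.≤-trans (ℕ.m≤n⇒m≤1+n (n≤n*2 (suc B))) (ℕ.m≤n+m (suc (suc B * 2)) l)) (n≤T _))))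
    (ψ≈progression l (suc B) (ℕ.≤-trans (ℕ.n≤1+n l) (ℕ.m≤n⇒m≤1+n l<B)))
    where
    dbl : ∀ B → B + B ≡ B * 2
    dbl = solve-∀
    bound : l + suc B ≤ B * 2
    bound = subst (_≤ B * 2) (sym (ℕ.+-suc l B)) (subst (suc l + B ≤_) (dbl B) (ℕ.+-monoˡ-≤ B l<B))

  symmetric₁ : ∀ l i → T l * 3 + T⁻ (i * 2) l ≡ T i * 3 + T⁻ (l * 2) i
  -- Adding 4li + l clears the subtraction inside `T⁻`, as in `T⁻-double`; the further i makes the
  -- added quantity symmetric too.
  symmetric₁ l i = double-cancel (ℕ.+-cancelʳ-≡ (4 * (l * i) + l + i) _ _
    (trans (closed l i) (trans (swap l i) (trans (sym (closed i l)) (cong (2T i l +_) (swap′ i l))))))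
    where
    2T : ℕ → ℕ → ℕ
    2T l i = T l * 3 + T⁻ (i * 2) l + (T l * 3 + T⁻ (i * 2) l)
    regroup : ∀ l i t d → t * 3 + d + (t * 3 + d) + (4 * (l * i) + l + i)
                          ≡ (t + t) * 3 + (d + d + (i * 2 * l + i * 2 * l + l)) + i
    regroup = solve-∀
    expand : ∀ l i → l * suc l * 3 + (i * 2 * (i * 2) + l * l + i * 2) + i ≡ 4 * (l * l) + 4 * (i * i) + 3 * l + 3 * i
    expand = solve-∀
    closed : ∀ l i → 2T l i + (4 * (l * i) + l + i) ≡ 4 * (l * l) + 4 * (i * i) + 3 * l + 3 * i
    closed l i = trans (regroup l i (T l) (T⁻ (i * 2) l))
      (trans (cong₂ (λ s t → s * 3 + t + i) (T-double l) (T⁻-double (i * 2) l)) (expand l i))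
    swap : ∀ l i → 4 * (l * l) + 4 * (i * i) + 3 * l + 3 * i ≡ 4 * (i * i) + 4 * (l * l) + 3 * i + 3 * l
    swap = solve-∀
    swap′ : ∀ l i → 4 * (l * i) + l + i ≡ 4 * (i * l) + i + l
    swap′ = solve-∀

  symmetric₂ : ∀ l i → T l * 3 + T (l + suc (i * 2)) ≡ T i * 3 + T (i + suc (l * 2))
  symmetric₂ l i = double-cancel (trans (closed l i) (trans (swap l i) (sym (closed i l))))
    where
    regroup : ∀ s t → s * 3 + t + (s * 3 + t) ≡ (s + s) * 3 + (t + t)
    regroup = solve-∀
    closed : ∀ l i → T l * 3 + T (l + suc (i * 2)) + (T l * 3 + T (l + suc (i * 2)))
                     ≡ l * suc l * 3 + (l + suc (i * 2)) * suc (l + suc (i * 2))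
    closed l i = trans (regroup (T l) _) (cong₂ (λ s t → s * 3 + t) (T-double l) (T-double (l + suc (i * 2))))
    swap : ∀ l i → l * suc l * 3 + (l + suc (i * 2)) * suc (l + suc (i * 2))
                   ≡ i * suc i * 3 + (i + suc (l * 2)) * suc (i + suc (l * 2))
    swap = solve-∀

  diagonal₁ : ∀ l → T⁻ (l * 2) l ≡ T l
  diagonal₁ l = trans (cong (λ a → T⁻ a l) (dbl l)) (lemma l 0)
    where
    dbl : ∀ l → l * 2 ≡ l + l
    dbl = solve-∀
    lemma : ∀ l m → T⁻ (l + (m + l)) l ≡ T (m + l)
    lemma zero    m = refl
    lemma (suc l) m = trans (cong (λ a → T⁻ (l + a) l) (ℕ.+-suc m l)) (trans (lemma l (suc m)) (cong T (sym (ℕ.+-suc m l))))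

  diagonal₂ : ∀ l → T l * 3 + T (l + suc (l * 2)) ≡ 1 + (T l * 3 + T l * 3 + (T l * 3 + T l * 3))
  diagonal₂ l = double-cancel (trans (regroup (T l) _) (trans
    (cong₂ (λ s t → s * 3 + t) (T-double l) (T-double (l + suc (l * 2))))
    (trans (expand l) (sym (trans (regroup′ (T l)) (cong (λ s → s * 12 + 2) (T-double l)))))))
    where
    regroup : ∀ s t → s * 3 + t + (s * 3 + t) ≡ (s + s) * 3 + (t + t)
    regroup = solve-∀
    regroup′ : ∀ s → 1 + (s * 3 + s * 3 + (s * 3 + s * 3)) + (1 + (s * 3 + s * 3 + (s * 3 + s * 3))) ≡ (s + s) * 12 + 2
    regroup′ = solve-∀
    expand : ∀ l → l * suc l * 3 + (l + suc (l * 2)) * suc (l + suc (l * 2)) ≡ l * suc l * 12 + 2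
    expand = solve-∀

  infix 9 _⁴
  _⁴ : Series → Series
  f ⁴ = f ⊛ f ⊛ (f ⊛ f)

  ψ₃ : Series
  ψ₃ = dilate 2 ψ

  module _ (L : ℕ) where
    open Mod L

    ⁴-cong : ∀ {f g} → f ≈[ L ] g → f ⁴ ≈[ L ] g ⁴
    ⁴-cong e = *-cong (*-cong e e) (*-cong e e)

    Σ-mono-⁴ : ∀ n (t : ℕ → ℕ) → Σ< n (λ k → mono (t k)) ⁴ ≈[ L ] Σ< n (λ k → mono (t k + t k + (t k + t k)))
    Σ-mono-⁴ n t = ≈-trans (*-cong (square t) (square t)) (square (λ k → t k + t k))
      where
      square : ∀ (t : ℕ → ℕ) → Σ< n (λ k → mono (t k)) ⊛ Σ< n (λ k → mono (t k)) ≈[ L ] Σ< n (λ k → mono (t k + t k))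
      square t = ≈-trans (Σ-square n _) (Σ-cong n λ k _ → ≈-sym (mono-+ (t k) (t k)))

    ψ₃≈Σ : ψ₃ ≈[ L ] Σ< L (λ k → mono (T k * 3))
    ψ₃≈Σ = ≈-trans (dilate-cong 2 (ψ≈Σ L)) (≈-trans (dilate-Σ 2 L monoT) (Σ-cong L λ k _ → dilate-mono 2 (T k)))

    ψ-ψ₃ : ψ ⊛ ψ₃ ≈[ L ] ψ ⁴ ⊕ mono 1 ⊛ ψ₃ ⁴
    ψ-ψ₃ = begin
      ψ ⊛ ψ₃
        ≈⟨ *-congˡ ψ₃≈Σ ⟩
      ψ ⊛ Σ< L (λ l → mono (T l * 3))
        ≈⟨ ⊛-Σ L ψ _ ⟩
      Σ< L (λ l → ψ ⊛ mono (T l * 3))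
        ≈⟨ Σ-cong L row ⟩
      Σ< L (λ l → Σ< L (term l))
        ≈⟨ Σ-symmetric L term (λ l i → +-cong (mono-≡ (symmetric₁ l i)) (mono-≡ (symmetric₂ l i))) ⟩
      Σ< L (λ l → term l l)
        ≈⟨ Σ-⊕ L _ _ ⟩
      Σ< L (λ l → mono (T l * 3 + T⁻ (l * 2) l)) ⊕ Σ< L (λ l → mono (T l * 3 + T (l + suc (l * 2))))
        ≈⟨ +-cong (Σ-cong L λ l _ → mono-≡ (trans (cong (T l * 3 +_) (diagonal₁ l)) (four (T l))))
                  (Σ-cong L λ l _ → ≈-trans (mono-≡ (diagonal₂ l)) (mono-+ 1 _)) ⟩
      Σ< L (λ l → mono (T l + T l + (T l + T l))) ⊕ Σ< L (λ l → mono 1 ⊛ mono (T l * 3 + T l * 3 + (T l * 3 + T l * 3)))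
        ≈⟨ +-cong (Σ-mono-⁴ L T) (≈-trans (*-congˡ (Σ-mono-⁴ L (λ l → T l * 3))) (⊛-Σ L (mono 1) _)) ⟨
      Σ< L monoT ⁴ ⊕ mono 1 ⊛ Σ< L (λ l → mono (T l * 3)) ⁴
        ≈⟨ +-cong (⁴-cong (ψ≈Σ L)) (*-congˡ (⁴-cong ψ₃≈Σ)) ⟨
      ψ ⁴ ⊕ mono 1 ⊛ ψ₃ ⁴ ∎
      where
      four : ∀ t → t * 3 + t ≡ t + t + (t + t)
      four = solve-∀

      term : ℕ → ℕ → Series
      term l i = mono (T l * 3 + T⁻ (i * 2) l) ⊕ mono (T l * 3 + T (l + suc (i * 2)))

      row : ∀ l → l < L → ψ ⊛ mono (T l * 3) ≈[ L ] Σ< L (term l)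
      row l l<L = begin
        ψ ⊛ mono (T l * 3)
          ≈⟨ *-comm ψ _ ⟩
        mono (T l * 3) ⊛ ψ
          ≈⟨ *-congˡ (ψ≈progression l L (ℕ.<⇒≤ l<L)) ⟨
        mono (T l * 3) ⊛ Σ< L (λ i → mono (T⁻ (i * 2) l) ⊕ monoT (l + suc (i * 2)))
          ≈⟨ ⊛-Σ L _ _ ⟩
        Σ< L (λ i → mono (T l * 3) ⊛ (mono (T⁻ (i * 2) l) ⊕ monoT (l + suc (i * 2))))
          ≈⟨ Σ-cong L (λ i _ → ≈-trans (distribˡ _ _ _) (+-cong (≈-sym (mono-+ (T l * 3) _)) (≈-sym (mono-+ (T l * 3) _)))) ⟩
        Σ< L (term l) ∎

  -- Reduction of F modulo 2

  odd : ℕ → Bool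
  odd zero    = false
  odd (suc n) = true xor odd n

  odd-+ : ∀ m n → odd (m + n) ≡ odd m xor odd n
  odd-+ zero    n = refl
  odd-+ (suc m) n = trans (cong (true xor_) (odd-+ m n)) (sym (𝔹.xor-assoc true (odd m) (odd n)))

  odd-* : ∀ m n → odd (m * n) ≡ odd m ∧ odd n
  odd-* zero    n = refl
  odd-* (suc m) n = trans (odd-+ n (m * n)) (trans (cong (odd n xor_) (odd-* m n)) (sym (𝔹.∧-distribʳ-xor (odd n) true (odd m))))

  parity : ℤ → Bool
  parity z = odd ℤ.∣ z ∣

  parity-⊖ : ∀ m n → parity (m ℤ.⊖ n) ≡ odd m xor odd n
  parity-⊖ m zero          = trans (cong parity (ℤ.⊖-≥ {m} z≤n)) (sym (𝔹.xor-identityʳ (odd m)))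
  parity-⊖ zero (suc n)    = refl
  parity-⊖ (suc m) (suc n) = trans (cong parity (ℤ.[1+m]⊖[1+n]≡m⊖n m n)) (trans (parity-⊖ m n) (lemma (odd m) (odd n)))
    where
    lemma : ∀ a b → a xor b ≡ (true xor a) xor (true xor b)
    lemma true  true  = refl
    lemma true  false = refl
    lemma false true  = refl
    lemma false false = refl

  parity-+ : ∀ x y → parity (x ℤ.+ y) ≡ parity x xor parity y
  parity-+ (ℤ.+ m)  (ℤ.+ n)  = odd-+ m n
  parity-+ (ℤ.+ m)  -[1+ n ] = parity-⊖ m (suc n)
  parity-+ -[1+ m ] (ℤ.+ n)  = trans (parity-⊖ n (suc m)) (𝔹.xor-comm (odd n) (odd (suc m)))
  parity-+ -[1+ m ] -[1+ n ] = trans (cong (odd ∘ suc) (sym (ℕ.+-suc m n))) (odd-+ (suc m) (suc n))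

  parity-* : ∀ x y → parity (x ℤ.* y) ≡ parity x ∧ parity y
  parity-* x y = trans (cong odd (ℤ.abs-* x y)) (odd-* ℤ.∣ x ∣ ℤ.∣ y ∣)

  reduce : List ℤ → Series
  reduce l n = parity (coeff l n)

  coeff-map-applyUpTo : ∀ (h : ℕ → ℤ) (f : ℕ → ℕ) L n → n < L → coeff (map h (applyUpTo f L)) n ≡ h (f n)
  coeff-map-applyUpTo h f (suc L) zero    _       = refl
  coeff-map-applyUpTo h f (suc L) (suc n) (s≤s l) = coeff-map-applyUpTo h (f ∘ suc) L n l

  reduce-upTo : ∀ h {f} {L} → (∀ n → parity (h n) ≡ f n) → reduce (map h (upTo L)) ≈[ L ] f
  reduce-upTo h e = mk λ n n<L → trans (cong parity (coeff-map-applyUpTo h id _ n n<L)) (e n)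

  -- `sumTo` grows at its last term, whereas `⊛` peels off the first.
  sumTo-front : ∀ n f → sumTo (suc n) f ≡ f 0 ℤ.+ sumTo n (f ∘ suc)
  sumTo-front zero    f = refl
  sumTo-front (suc n) f = trans (cong (ℤ._+ f (suc (suc n))) (sumTo-front n f)) (ℤ.+-assoc (f 0) _ _)

  parity-convolution : ∀ n (f g : ℕ → ℤ) → parity (sumTo n (λ i → f i ℤ.* g (n ∸ i))) ≡ ((parity ∘ f) ⊛ (parity ∘ g)) n
  parity-convolution zero    f g = trans (parity-* (f 0) (g 0)) (sym (⊛-zero _ _))
  parity-convolution (suc n) f g = begin
    parity (sumTo (suc n) (λ i → f i ℤ.* g (suc n ∸ i)))
      ≡⟨ cong parity (sumTo-front n _) ⟩
    parity (f 0 ℤ.* g (suc n) ℤ.+ sumTo n (λ i → f (suc i) ℤ.* g (n ∸ i)))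
      ≡⟨ parity-+ (f 0 ℤ.* g (suc n)) _ ⟩
    parity (f 0 ℤ.* g (suc n)) xor parity (sumTo n (λ i → f (suc i) ℤ.* g (n ∸ i)))
      ≡⟨ cong₂ _xor_ (parity-* (f 0) (g (suc n))) (parity-convolution n (f ∘ suc) g) ⟩
    (parity (f 0) ∧ parity (g (suc n))) xor ((parity ∘ f ∘ suc) ⊛ (parity ∘ g)) n
      ≡⟨ ⊛-suc _ _ n ⟨
    ((parity ∘ f) ⊛ (parity ∘ g)) (suc n) ∎
    where open ≡-Reasoning

  reduce-mulT : ∀ L f g → reduce (mulT L f g) ≈[ L ] reduce f ⊛ reduce g
  reduce-mulT L f g = reduce-upTo _ λ n → parity-convolution n (coeff f) (coeff g)

  parity-if : ∀ b → parity (if b then ℤ.+ 1 else ℤ.+ 0) ≡ b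
  parity-if true  = refl
  parity-if false = refl

  reduce-one : ∀ L f → reduce (powT L f 0) ≈[ L ] 𝟙
  reduce-one L f = reduce-upTo _ λ { zero → refl ; (suc n) → refl }

  reduce-geom : ∀ L m → reduce (geom L m) ≈[ L ] geometric m
  reduce-geom L m = reduce-upTo _ λ n → parity-if _

  reduce-oneMinus : ∀ L m → reduce (oneMinus L (suc m)) ≈[ L ] one+mono (suc m)
  reduce-oneMinus L m = reduce-upTo _ λ { zero → sym (⊕-at 𝟙 (mono (suc m)) 0)
                                        ; (suc n) → trans (lemma n m) (sym (⊕-at 𝟙 (mono (suc m)) (suc n))) }
    where
    lemma : ∀ n m → parity (if n ≡ᵇ m then -[1+ 0 ] else ℤ.+ 0) ≡ (m ≡ᵇ n)
    lemma zero    zero    = refl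
    lemma zero    (suc m) = refl
    lemma (suc n) zero    = refl
    lemma (suc n) (suc m) = lemma n m

  euler₃ : ℕ → Series
  euler₃ n = Π< n λ i → one+mono (3 * suc i)

  module _ (L : ℕ) where
    open Mod L
    open Algebra.Properties.CommutativeSemiring.Exp (series L) using (^-distrib-*)

    one^ : ∀ n → 𝟙 ^ n ≈[ L ] 𝟙
    one^ zero    = ≈-refl
    one^ (suc n) = ≈-trans (*-identityˡ _) (one^ n)

    reduce-powT : ∀ f e → reduce (powT L f e) ≈[ L ] reduce f ^ e
    reduce-powT f zero    = reduce-one L f
    reduce-powT f (suc e) = ≈-trans (reduce-mulT L f (powT L f e)) (*-congˡ (reduce-powT f e))

    reduce-mulT-cong : ∀ f g {u v} → reduce f ≈[ L ] u → reduce g ≈[ L ] v → reduce (mulT L f g) ≈[ L ] u ⊛ v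
    reduce-mulT-cong f g d e = ≈-trans (reduce-mulT L f g) (*-cong d e)

    reduce-powT-cong : ∀ f {u} e → reduce f ≈[ L ] u → reduce (powT L f e) ≈[ L ] u ^ e
    reduce-powT-cong f e eq = ≈-trans (reduce-powT f e) (^-congˡ e eq)

    -- Modulo 2, 1 - q^(2m) and 1 - q^(6m) are the squares of 1 - q^m and 1 - q^(3m). So the first
    -- cancels against the cubed denominator down to one cube, and the ninth powers collapse after
    -- multiplication by a second copy of (1 - q^(3m))⁹. Here m stands for `suc m`, and 5 + 6 * m is
    -- one less than six times it, as `geom` expects.
    reduce-factor : ∀ m → reduce (factorT L m) ⊛ one+mono (3 * suc m) ^ 9 ≈[ L ] one+mono (suc m) ^ 3
    reduce-factor m = begin
      reduce (factorT L m) ⊛ v ^ 9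
        ≈⟨ *-congʳ (reduce-mulT-cong (powT L a 3) (mulT L (powT L b 9) (mulT L (powT L c 3) (powT L d 9)))
             (reduce-powT-cong a 3 (reduce-oneMinus L _))
             (reduce-mulT-cong (powT L b 9) (mulT L (powT L c 3) (powT L d 9))
               (reduce-powT-cong b 9 (reduce-oneMinus L _))
               (reduce-mulT-cong (powT L c 3) (powT L d 9)
                 (reduce-powT-cong c 3 (reduce-geom L _)) (reduce-powT-cong d 9 (reduce-geom L _))))) ⟩
      one+mono (2 * suc m) ^ 3 ⊛ (v ^ 9 ⊛ (u⁻¹ ^ 3 ⊛ w ^ 9)) ⊛ v ^ 9
        ≈⟨ solve 5 (λ a b c d e → a :* (b :* (c :* d)) :* e := (a :* c) :* ((b :* e) :* d)) ≈-refl
             (one+mono (2 * suc m) ^ 3) (v ^ 9) (u⁻¹ ^ 3) (w ^ 9) (v ^ 9) ⟩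
      one+mono (2 * suc m) ^ 3 ⊛ u⁻¹ ^ 3 ⊛ (v ^ 9 ⊛ v ^ 9 ⊛ w ^ 9)
        ≈⟨ *-cong (^-distrib-* _ u⁻¹ 3) (≈-trans (^-distrib-* (v ⊛ v) w 9) (*-congʳ (^-distrib-* v v 9))) ⟨
      (one+mono (2 * suc m) ⊛ u⁻¹) ^ 3 ⊛ (v ⊛ v ⊛ w) ^ 9
        ≈⟨ *-cong (^-congˡ 3 u-part) (≈-trans (^-congˡ 9 v-part) (one^ 9)) ⟩
      u ^ 3 ⊛ 𝟙
        ≈⟨ *-identityʳ _ ⟩
      u ^ 3 ∎
      where
      a b c d : List ℤ
      a = oneMinus L (2 * suc m)
      b = oneMinus L (3 * suc m)
      c = geom L m
      d = geom L (5 + 6 * m)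
      u u⁻¹ v w : Series
      u   = one+mono (suc m)
      u⁻¹ = geometric m
      v   = one+mono (3 * suc m)
      w   = geometric (5 + 6 * m)
      u-part : one+mono (2 * suc m) ⊛ u⁻¹ ≈[ L ] u
      u-part = begin
        one+mono (2 * suc m) ⊛ u⁻¹   ≈⟨ *-congʳ (≈-trans (+-congˡ (mono-≡ (ℕ.*-comm 2 (suc m)))) (one+mono-square (suc m))) ⟩
        u ⊛ u ⊛ u⁻¹                  ≈⟨ *-assoc u u u⁻¹ ⟩
        u ⊛ (u ⊛ u⁻¹)                ≈⟨ *-congˡ (geometric-inverse m) ⟩
        u ⊛ 𝟙                        ≈⟨ *-identityʳ u ⟩
        u                            ∎
      v-part : v ⊛ v ⊛ w ≈[ L ] 𝟙
      v-part = ≈-trans (*-congʳ (≈-sym (≈-trans (+-congˡ (mono-≡ (six m))) (one+mono-square (3 * suc m))))) (geometric-inverse (5 + 6 * m))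
        where
        six : ∀ m → 6 + 6 * m ≡ 3 * suc m * 2
        six = solve-∀

    reduce-prodFactors : ∀ M → reduce (prodFactors L M) ⊛ euler₃ M ^ 9 ≈[ L ] euler M ^ 3
    reduce-prodFactors zero    = ≈-trans (*-cong (reduce-one L []) (one^ 9)) (≈-trans (*-identityˡ 𝟙) (≈-sym (one^ 3)))
    reduce-prodFactors (suc M) = begin
      reduce (prodFactors L (suc M)) ⊛ euler₃ (suc M) ^ 9
        ≈⟨ *-cong (reduce-mulT L (factorT L M) (prodFactors L M)) (^-distrib-* (euler₃ M) _ 9) ⟩
      reduce (factorT L M) ⊛ reduce (prodFactors L M) ⊛ (euler₃ M ^ 9 ⊛ one+mono (3 * suc M) ^ 9)
        ≈⟨ solve 4 (λ a b c d → (a :* b) :* (c :* d) := (b :* c) :* (a :* d)) ≈-refl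
             (reduce (factorT L M)) (reduce (prodFactors L M)) (euler₃ M ^ 9) (one+mono (3 * suc M) ^ 9) ⟩
      reduce (prodFactors L M) ⊛ euler₃ M ^ 9 ⊛ (reduce (factorT L M) ⊛ one+mono (3 * suc M) ^ 9)
        ≈⟨ *-cong (reduce-prodFactors M) (reduce-factor M) ⟩
      euler M ^ 3 ⊛ one+mono (suc M) ^ 3
        ≈⟨ ^-distrib-* (euler M) _ 3 ⟨
      euler (suc M) ^ 3 ∎

    dilate-𝟙 : dilate 2 𝟙 ≈[ L ] 𝟙
    dilate-𝟙 = ≈-trans (dilate-cong 2 (≈-sym mono-0)) (≈-trans (dilate-mono 2 0) mono-0)

    euler₃≈ : ∀ n → euler₃ n ≈[ L ] dilate 2 (euler n)
    euler₃≈ zero    = ≈-sym dilate-𝟙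
    euler₃≈ (suc n) = ≈-sym (begin
      dilate 2 (euler n ⊛ one+mono (suc n))
        ≈⟨ dilate-⊛ 2 _ _ ⟩
      dilate 2 (euler n) ⊛ dilate 2 (𝟙 ⊕ mono (suc n))
        ≈⟨ *-cong (≈-sym (euler₃≈ n)) (≈-trans (dilate-⊕ 2 _ _) (+-cong dilate-𝟙 (dilate-mono 2 (suc n)))) ⟩
      euler₃ n ⊛ one+mono (suc n * 3)
        ≈⟨ *-congˡ (+-congˡ (mono-≡ (ℕ.*-comm (suc n) 3))) ⟩
      euler₃ (suc n) ∎)

  -- The equation relating F, ψ(X) and ψ(X³)

  infix 9 _³
  _³ : Series → Series
  f ³ = f ⊛ f ⊛ f

  module _ (L : ℕ) where
    open Mod L

    ³-cong : ∀ {f g} → f ≈[ L ] g → f ³ ≈[ L ] g ³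
    ³-cong e = *-cong (*-cong e e) e

    dilate-³ : ∀ f → dilate 2 (f ³) ≈[ L ] dilate 2 f ³
    dilate-³ f = ≈-trans (dilate-⊛ 2 _ f) (*-congʳ (dilate-⊛ 2 f f))

    cancelʳ : ∀ {f g u u⁻¹} → u ⊛ u⁻¹ ≈[ L ] 𝟙 → f ⊛ u ≈[ L ] g ⊛ u → f ≈[ L ] g
    cancelʳ {f} {g} {u} {u⁻¹} unit e = begin
      f                  ≈⟨ *-identityʳ f ⟨
      f ⊛ 𝟙              ≈⟨ *-congˡ unit ⟨
      f ⊛ (u ⊛ u⁻¹)      ≈⟨ *-assoc f u u⁻¹ ⟨
      f ⊛ u ⊛ u⁻¹        ≈⟨ *-congʳ e ⟩
      g ⊛ u ⊛ u⁻¹        ≈⟨ *-assoc g u u⁻¹ ⟩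
      g ⊛ (u ⊛ u⁻¹)      ≈⟨ *-congˡ unit ⟩
      g ⊛ 𝟙              ≈⟨ *-identityʳ g ⟩
      g                  ∎

    ³-inverse : ∀ {f f⁻¹} → f ⊛ f⁻¹ ≈[ L ] 𝟙 → f ³ ⊛ f⁻¹ ³ ≈[ L ] 𝟙
    ³-inverse {f} {f⁻¹} e = ≈-trans
      (solve 2 (λ f g → (f :* f :* f) :* (g :* g :* g) := (f :* g) :* (f :* g) :* (f :* g)) ≈-refl f f⁻¹)
      (≈-trans (³-cong e) (≈-trans (*-congʳ (*-identityˡ 𝟙)) (*-identityˡ 𝟙)))

  ψ⁻¹ : ℕ → Series
  ψ⁻¹ L = euler⁻¹ L ³

  ψ-inverse : ∀ L → ψ ⊛ ψ⁻¹ L ≈[ L ] 𝟙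
  ψ-inverse L = ≈-trans (*-congʳ (≈-sym (euler-cube-weak L))) (³-inverse L (euler-inverse L))
    where open Mod L

  ψ₃-inverse : ∀ L → ψ₃ ⊛ dilate 2 (ψ⁻¹ L) ≈[ L ] 𝟙
  ψ₃-inverse L = ≈-trans (≈-sym (dilate-⊛ 2 _ _)) (≈-trans (dilate-cong 2 (ψ-inverse L)) (dilate-𝟙 L))

  F : Series
  F n = parity (Fcoeff n)

  -- The ninth power splits as a cube of cubes: the inner cube is ψ at X³ by `euler-cube`, and the
  -- outer one remains.
  prodFactors-ψ : ∀ N → reduce (prodFactors (suc N) N) ⊛ ψ₃ ³ ≈[ suc N ] ψ
  prodFactors-ψ N = begin
    P ⊛ ψ₃ ³                              ≈⟨ *-congˡ (³-cong (suc N) (dilate-cong 2 (euler-cube N))) ⟨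
    P ⊛ dilate 2 (euler N ³) ³              ≈⟨ *-congˡ (³-cong (suc N) (dilate-³ (suc N) (euler N))) ⟩
    P ⊛ dilate 2 (euler N) ³ ³              ≈⟨ *-congˡ (solve 1 (λ x → (x :* x :* x) :* (x :* x :* x) :* (x :* x :* x) := x :^ 9) ≈-refl _) ⟩
    P ⊛ dilate 2 (euler N) ^ 9              ≈⟨ *-congˡ (^-congˡ 9 (euler₃≈ (suc N) N)) ⟨
    P ⊛ euler₃ N ^ 9                   ≈⟨ reduce-prodFactors (suc N) N ⟩
    euler N ^ 3                             ≈⟨ solve 1 (λ x → x :^ 3 := x :* x :* x) ≈-refl (euler N) ⟩
    euler N ³                               ≈⟨ euler-cube N ⟩
    ψ                                     ∎
    where
    open Mod (suc N)
    P : Series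
    P = reduce (prodFactors (suc N) N)

  -- Coefficient n of F comes from a truncation of its own. It agrees with the longer product
  -- because both solve the equation of `prodFactors-ψ` modulo X^(n+1), in which the cube of ψ₃ is a
  -- unit.
  F-prodFactors : ∀ N → F ≈[ suc N ] reduce (prodFactors (suc N) N)
  F-prodFactors N = mk λ { n (s≤s n≤N) → at (cancelʳ (suc n) (³-inverse (suc n) (ψ₃-inverse (suc n)))
    (≈-trans (prodFactors-ψ n) (≈-sym (weaken (s≤s n≤N) (prodFactors-ψ N))))) n ℕ.≤-refl }

  F-ψ : ∀ L → ψ₃ ³ ⊛ F ≈[ L ] ψ
  F-ψ L = weaken (ℕ.n≤1+n L) (≈-trans (*-comm _ F) (≈-trans (*-congʳ (F-prodFactors L)) (prodFactors-ψ L)))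
    where open Mod (suc L)

  -- Dissection of F

  section-Σ : ∀ k r n f {L} → section k r (Σ< n f) ≈[ L ] Σ< n (λ i → section k r (f i))
  section-Σ k r zero    f = ≈-refl
  section-Σ k r (suc n) f = ≈-trans (section-⊕ k r _ _) (⊕-cong (section-Σ k r n f) ≈-refl)

  section-mono : ∀ k r → r ≤ k → ∀ m e {L} → section k r (mono (m * suc k + e)) ≈[ L ] mono m ⊛ section k r (mono e)
  section-mono k r r≤k m e {L} = ≈-trans (section-cong k r
    (λ L → ≈-trans (mono-+ (m * suc k) e) (⊛-cong (≈-sym (dilate-mono k m)) ≈-refl)) L) (section-dilate-⊛ k r r≤k (mono m) (mono e))

  Σ-triples : ∀ n f {L} → Σ< (n * 3) f ≈[ L ] Σ< n (λ i → f (i * 3) ⊕ f (suc (i * 3)) ⊕ f (suc (suc (i * 3))))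
  Σ-triples zero    f = ≈-refl
  Σ-triples (suc n) f {L} = ≈-trans
    (solve 4 (λ s a b c → s :+ a :+ b :+ c := s :+ (a :+ b :+ c)) ≈-refl (Σ< (n * 3) f) _ _ _)
    (+-congʳ (Σ-triples n f))
    where open Mod L

  T-3i : ∀ i → T (i * 3) ≡ (i * i + T i) * 3 + 0
  T-3i i = double-cancel (trans (T-double (i * 3)) (sym (trans (regroup i (T i)) (trans (cong (λ s → 6 * (i * i) + s * 3) (T-double i)) (expand i)))))
    where
    regroup : ∀ i t → (i * i + t) * 3 + 0 + ((i * i + t) * 3 + 0) ≡ 6 * (i * i) + (t + t) * 3
    regroup = solve-∀
    expand : ∀ i → 6 * (i * i) + i * suc i * 3 ≡ i * 3 * suc (i * 3)
    expand = solve-∀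

  T-3i+1 : ∀ i → T (suc (i * 3)) ≡ T i * 3 * 3 + 1
  T-3i+1 i = double-cancel (trans (T-double (suc (i * 3))) (sym (trans (regroup (T i)) (trans (cong (λ s → s * 9 + 2) (T-double i)) (expand i)))))
    where
    regroup : ∀ t → t * 3 * 3 + 1 + (t * 3 * 3 + 1) ≡ (t + t) * 9 + 2
    regroup = solve-∀
    expand : ∀ i → i * suc i * 9 + 2 ≡ suc (i * 3) * suc (suc (i * 3))
    expand = solve-∀

  T-3i+2 : ∀ i → T (suc (suc (i * 3))) ≡ (suc i * suc i + T i) * 3 + 0
  T-3i+2 i = double-cancel (trans (T-double (suc (suc (i * 3)))) (sym (trans (regroup i (T i)) (trans (cong (λ s → 6 * (suc i * suc i) + s * 3) (T-double i)) (expand i)))))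
    where
    regroup : ∀ i t → (suc i * suc i + t) * 3 + 0 + ((suc i * suc i + t) * 3 + 0) ≡ 6 * (suc i * suc i) + (t + t) * 3
    regroup = solve-∀
    expand : ∀ i → 6 * (suc i * suc i) + i * suc i * 3 ≡ suc (suc (i * 3)) * suc (suc (suc (i * 3)))
    expand = solve-∀

  section-1-0 : ∀ {L} → section 1 0 𝟙 ≈[ L ] 𝟙
  section-1-0 = everywhere λ { zero → refl ; (suc n) → refl }

  section-1-1 : ∀ {L} → section 1 1 𝟙 ≈[ L ] 𝟘
  section-1-1 = everywhere λ { zero → refl ; (suc n) → refl }

  section-X-0 : ∀ {L} → section 1 0 (mono 1) ≈[ L ] 𝟘
  section-X-0 = everywhere λ { zero → refl ; (suc n) → refl }

  section-X-1 : ∀ {L} → section 1 1 (mono 1) ≈[ L ] 𝟙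
  section-X-1 = everywhere λ { zero → refl ; (suc n) → refl }

  -- T(3i) and T(3i+2) are divisible by 3, while T(3i+1) = 3·3T(i) + 1; only the last family
  -- survives, leaving the exponents 3T(i).
  section-ψ : ∀ L → section 2 1 ψ ≈[ L ] ψ₃
  section-ψ L = ≈-trans (mk λ n n<L → at (ψ≈Σ (L * 3)) (progression 2 1 n) (bound n L n<L)) (begin
    section 2 1 (Σ< (L * 3) monoT)
      ≈⟨ section-cong 2 1 (λ _ → Σ-triples L monoT) L ⟩
    section 2 1 (Σ< L (λ i → monoT (i * 3) ⊕ monoT (suc (i * 3)) ⊕ monoT (suc (suc (i * 3)))))
      ≈⟨ section-Σ 2 1 L _ ⟩
    Σ< L (λ i → section 2 1 (monoT (i * 3) ⊕ monoT (suc (i * 3)) ⊕ monoT (suc (suc (i * 3)))))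
      ≈⟨ Σ-cong L (λ i _ → term i) ⟩
    Σ< L (λ i → mono (T i * 3))
      ≈⟨ ψ₃≈Σ L ⟨
    ψ₃ ∎)
    where
    open Mod L
    bound : ∀ n L → n < L → progression 2 1 n < L * 3
    bound zero    (suc L) _       = s≤s (s≤s z≤n)
    bound (suc n) (suc L) (s≤s l) = s≤s (s≤s (s≤s (bound n L l)))

    multiple : ∀ m → section 2 1 (mono (m * 3 + 0)) ≈[ L ] 𝟘
    multiple m = ≈-trans (section-mono 2 1 (s≤s z≤n) m 0) (≈-trans (*-congˡ (everywhere λ { zero → refl ; (suc n) → refl })) (zeroʳ _))

    successor : ∀ m → section 2 1 (mono (m * 3 + 1)) ≈[ L ] mono m
    successor m = ≈-trans (section-mono 2 1 (s≤s z≤n) m 1) (≈-trans (*-congˡ (everywhere λ { zero → refl ; (suc n) → refl })) (*-identityʳ _))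

    via : ∀ {a b f} → a ≡ b → section 2 1 (mono b) ≈[ L ] f → section 2 1 (mono a) ≈[ L ] f
    via refl e = e

    term : ∀ i → section 2 1 (monoT (i * 3) ⊕ monoT (suc (i * 3)) ⊕ monoT (suc (suc (i * 3)))) ≈[ L ] mono (T i * 3)
    term i = begin
      section 2 1 (monoT (i * 3) ⊕ monoT (suc (i * 3)) ⊕ monoT (suc (suc (i * 3))))
        ≈⟨ ≈-trans (section-⊕ 2 1 _ _) (+-congʳ (section-⊕ 2 1 _ _)) ⟩
      section 2 1 (monoT (i * 3)) ⊕ section 2 1 (monoT (suc (i * 3))) ⊕ section 2 1 (monoT (suc (suc (i * 3))))
        ≈⟨ +-cong (+-cong (via (T-3i i) (multiple (i * i + T i))) (via (T-3i+1 i) (successor (T i * 3)))) (via (T-3i+2 i) (multiple (suc i * suc i + T i))) ⟩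
      𝟘 ⊕ mono (T i * 3) ⊕ 𝟘
        ≈⟨ ≈-trans (+-identityʳ _) (+-identityˡ _) ⟩
      mono (T i * 3) ∎

  section-square : ∀ r → r ≤ 1 → ∀ f g {L} → section 1 r (f ⊛ f ⊛ g) ≈[ L ] f ⊛ section 1 r g
  section-square r r≤1 f g {L} = ≈-trans (section-cong 1 r (λ L → ⊛-cong (frobenius f) ≈-refl) L) (section-dilate-⊛ 1 r r≤1 f g)

  -- Y_d collects the coefficients of F of index ≡ 4 modulo d.
  Y₃ Y₆ Y₁₂ Y₂₄ : Series
  Y₃  = section 2 1 F
  Y₆  = section 1 1 Y₃
  Y₁₂ = section 1 0 Y₆
  Y₂₄ = section 1 0 Y₁₂

  ψ³-Y₃ : ∀ L → ψ ³ ⊛ Y₃ ≈[ L ] ψ₃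
  ψ³-Y₃ L = begin
    ψ ³ ⊛ Y₃                              ≈⟨ section-dilate-⊛ 2 1 (s≤s z≤n) (ψ ³) F ⟨
    section 2 1 (dilate 2 (ψ ³) ⊛ F)      ≈⟨ section-cong 2 1 (λ L → ≈-trans (⊛-cong (dilate-³ L ψ) ≈-refl) (F-ψ L)) L ⟩
    section 2 1 ψ                         ≈⟨ section-ψ L ⟩
    ψ₃                                    ∎
    where open Mod L

  ψ⁴-Y₃ : ∀ L → ψ ⁴ ⊛ Y₃ ≈[ L ] ψ ⁴ ⊕ mono 1 ⊛ ψ₃ ⁴
  ψ⁴-Y₃ L = begin
    ψ ⁴ ⊛ Y₃              ≈⟨ solve 2 (λ p y → (p :* p) :* (p :* p) :* y := p :* (p :* p :* p :* y)) ≈-refl ψ Y₃ ⟩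
    ψ ⊛ (ψ ³ ⊛ Y₃)        ≈⟨ *-congˡ (ψ³-Y₃ L) ⟩
    ψ ⊛ ψ₃                ≈⟨ ψ-ψ₃ L ⟩
    ψ ⁴ ⊕ mono 1 ⊛ ψ₃ ⁴   ∎
    where open Mod L

  -- Both summands are a square times 1 or X, so only the sections of 1 and X have to be known.
  section-ψ⁴+Xψ₃⁴ : ∀ r → r ≤ 1 → ∀ L → section 1 r (ψ ⁴ ⊕ mono 1 ⊛ ψ₃ ⁴) ≈[ L ]
    ψ ⊛ ψ ⊛ section 1 r 𝟙 ⊕ ψ₃ ⊛ ψ₃ ⊛ section 1 r (mono 1)
  section-ψ⁴+Xψ₃⁴ r r≤1 L = ≈-trans (section-⊕ 1 r _ _) (+-cong
    (≈-trans (section-cong 1 r (λ L → ≈-sym (Mod.*-identityʳ L _)) L) (section-square r r≤1 (ψ ⊛ ψ) 𝟙))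
    (≈-trans (section-cong 1 r (λ L → Mod.*-comm L _ _) L) (section-square r r≤1 (ψ₃ ⊛ ψ₃) (mono 1))))
    where open Mod L

  ψ²-Y₆ : ∀ L → ψ ⊛ ψ ⊛ Y₆ ≈[ L ] ψ₃ ⊛ ψ₃ ⊛ 𝟙
  ψ²-Y₆ L = begin
    ψ ⊛ ψ ⊛ Y₆                                                       ≈⟨ section-square 1 ℕ.≤-refl (ψ ⊛ ψ) Y₃ ⟨
    section 1 1 (ψ ⁴ ⊛ Y₃)                                           ≈⟨ section-cong 1 1 ψ⁴-Y₃ L ⟩
    section 1 1 (ψ ⁴ ⊕ mono 1 ⊛ ψ₃ ⁴)                                ≈⟨ section-ψ⁴+Xψ₃⁴ 1 ℕ.≤-refl L ⟩
    ψ ⊛ ψ ⊛ section 1 1 𝟙 ⊕ ψ₃ ⊛ ψ₃ ⊛ section 1 1 (mono 1)           ≈⟨ +-cong (≈-trans (*-congˡ section-1-1) (zeroʳ _)) (*-congˡ section-X-1) ⟩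
    𝟘 ⊕ ψ₃ ⊛ ψ₃ ⊛ 𝟙                                                  ≈⟨ +-identityˡ _ ⟩
    ψ₃ ⊛ ψ₃ ⊛ 𝟙                                                      ∎
    where open Mod L

  ψ-Y₁₂ : ∀ L → ψ ⊛ Y₁₂ ≈[ L ] ψ₃
  ψ-Y₁₂ L = begin
    ψ ⊛ Y₁₂                     ≈⟨ section-square 0 z≤n ψ Y₆ ⟨
    section 1 0 (ψ ⊛ ψ ⊛ Y₆)    ≈⟨ section-cong 1 0 ψ²-Y₆ L ⟩
    section 1 0 (ψ₃ ⊛ ψ₃ ⊛ 𝟙)   ≈⟨ section-square 0 z≤n ψ₃ 𝟙 ⟩
    ψ₃ ⊛ section 1 0 𝟙          ≈⟨ *-congˡ section-1-0 ⟩
    ψ₃ ⊛ 𝟙                      ≈⟨ *-identityʳ ψ₃ ⟩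
    ψ₃                          ∎
    where open Mod L

  ψ-Y₂₄ : ∀ L → ψ ⊛ Y₂₄ ≈[ L ] ψ ⊛ ψ
  ψ-Y₂₄ L = begin
    ψ ⊛ Y₂₄                                                          ≈⟨ section-square 0 z≤n ψ Y₁₂ ⟨
    section 1 0 (ψ ⊛ ψ ⊛ Y₁₂)                                        ≈⟨ section-cong 1 0 (λ L → ≈-trans (Mod.*-assoc L ψ ψ Y₁₂)
                                                                          (≈-trans (⊛-cong ≈-refl (ψ-Y₁₂ L)) (ψ-ψ₃ L))) L ⟩
    section 1 0 (ψ ⁴ ⊕ mono 1 ⊛ ψ₃ ⁴)                                ≈⟨ section-ψ⁴+Xψ₃⁴ 0 z≤n L ⟩
    ψ ⊛ ψ ⊛ section 1 0 𝟙 ⊕ ψ₃ ⊛ ψ₃ ⊛ section 1 0 (mono 1)           ≈⟨ +-cong (*-congˡ section-1-0) (≈-trans (*-congˡ section-X-0) (zeroʳ _)) ⟩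
    ψ ⊛ ψ ⊛ 𝟙 ⊕ 𝟘                                                    ≈⟨ ≈-trans (+-identityʳ _) (*-identityʳ _) ⟩
    ψ ⊛ ψ                                                            ∎
    where open Mod L

  Y₂₄≈ψ : ∀ L → Y₂₄ ≈[ L ] ψ
  Y₂₄≈ψ L = cancelʳ L (ψ-inverse L) (≈-trans (*-comm Y₂₄ ψ) (ψ-Y₂₄ L))
    where open Mod L

  -- The index of F is one more than that of 𝒥₆. The nested sections send m to 2m, 4m, 8m + 1 and
  -- finally 3(8m + 1) + 1.
  F-24m+4 : ∀ m → F (suc (3 * (1 + 8 * m))) ≡ ψ m
  F-24m+4 m = trans (cong F (sym index)) (pointwise Y₂₄≈ψ m)
    where
    index : progression 2 1 (progression 1 1 (progression 1 0 (progression 1 0 m))) ≡ suc (3 * (1 + 8 * m))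
    index rewrite progression≡ 1 0 m | progression≡ 1 0 (m * 2 + 0) | progression≡ 1 1 ((m * 2 + 0) * 2 + 0)
                | progression≡ 2 1 (((m * 2 + 0) * 2 + 0) * 2 + 1) = expand m
      where
      expand : ∀ m → (((m * 2 + 0) * 2 + 0) * 2 + 1) * 3 + 1 ≡ suc (3 * (1 + 8 * m))
      expand = solve-∀

  ψ-nontriangular : ∀ n → (∀ k → T k ≢ n) → ψ n ≡ false
  ψ-nontriangular n none = go (suc n)
    where
    ≢⇒false : ∀ a b → a ≢ b → (a ≡ᵇ b) ≡ false
    ≢⇒false zero    zero    ne = ⊥-elim (ne refl)
    ≢⇒false zero    (suc b) ne = refl
    ≢⇒false (suc a) zero    ne = refl
    ≢⇒false (suc a) (suc b) ne = ≢⇒false a b λ e → ne (cong suc e)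
    go : ∀ B → Σ< B monoT n ≡ false
    go zero    = refl
    go (suc B) = trans (⊕-at _ _ n) (cong₂ _xor_ (go B) (≢⇒false (T B) n (none B)))

  -- Arithmetic of the index

  even⇒2∣ : ∀ n → odd n ≡ false → 2 ∣ n
  even⇒2∣ zero          _ = divides 0 refl
  even⇒2∣ (suc (suc n)) e = ∣m∣n⇒∣m+n ∣-refl (even⇒2∣ n (trans (sym (𝔹.not-involutive (odd n))) e))

  ThreeFiveSeven : ℕ → Set
  ThreeFiveSeven q = q % 8 ≡ 3 ⊎ q % 8 ≡ 5 ⊎ q % 8 ≡ 7

  square%8 : ∀ q → ThreeFiveSeven q → (q * q) % 8 ≡ 1
  square%8 q c = trans (%-distribˡ-* q q 8) (residue c)
    where
    residue : ThreeFiveSeven q → ((q % 8) * (q % 8)) % 8 ≡ 1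
    residue (inj₁ e)        = cong (λ r → (r * r) % 8) e
    residue (inj₂ (inj₁ e)) = cong (λ r → (r * r) % 8) e
    residue (inj₂ (inj₂ e)) = cong (λ r → (r * r) % 8) e

  one%8-* : ∀ a b → a % 8 ≡ 1 → b % 8 ≡ 1 → (a * b) % 8 ≡ 1
  one%8-* a b d e = trans (%-distribˡ-* a b 8) (cong₂ (λ r s → (r * s) % 8) d e)

  prodSq%8 : ∀ {k} (ps : Vec ℕ k) → All ThreeFiveSeven ps → prodSq ps % 8 ≡ 1
  prodSq%8 []       []       = refl
  prodSq%8 (q ∷ qs) (c ∷ cs) = one%8-* (q * q) (prodSq qs) (square%8 q c) (prodSq%8 qs cs)

  prime∣square : ∀ {p s} → Prime p → p ∣ s * s → p ∣ s
  prime∣square {s = s} pr d with euclidsLemma s s pr d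
  ... | inj₁ p∣s = p∣s
  ... | inj₂ p∣s = p∣s

  -- The primes may repeat or equal p, so they are stripped one at a time: q divides s, and q²
  -- cancels on both sides. At the end p·w = s² would force p² to divide p·w, against p not dividing
  -- w.
  prodSq-*-nonsquare : ∀ {k} (ps : Vec ℕ k) → All Prime ps → ∀ {p w} → Prime p → ¬ p ∣ w →
                       ∀ s → prodSq ps * (p * w) ≢ s * s
  prodSq-*-nonsquare [] [] {p} {w} pr p∤w s e
    with prime∣square {s = s} pr (divides w (trans (sym e) (trans (ℕ.*-identityˡ (p * w)) (ℕ.*-comm p w))))
  ... | divides t refl = p∤w (divides (t * t) (ℕ.*-cancelˡ-≡ w (t * t * p) p
          (trans (sym (ℕ.*-identityˡ (p * w))) (trans e (regroup t p)))))
    where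
    instance _ = prime⇒nonZero pr
    regroup : ∀ t p → t * p * (t * p) ≡ p * (t * t * p)
    regroup = solve-∀
  prodSq-*-nonsquare (q ∷ qs) (prq ∷ prs) {p} {w} pr p∤w s e
    with prime∣square {s = s} prq (divides (q * prodSq qs * (p * w)) (trans (sym e) (regroup q (prodSq qs) (p * w))))
    where
    regroup : ∀ q P x → q * q * P * x ≡ q * P * x * q
    regroup = solve-∀
  ... | divides t refl = prodSq-*-nonsquare qs prs pr p∤w t
          (ℕ.*-cancelˡ-≡ _ _ q (ℕ.*-cancelˡ-≡ _ _ q (trans (left q (prodSq qs) (p * w)) (trans e (right t q)))))
    where
    instance _ = prime⇒nonZero prq
    left : ∀ q P x → q * (q * (P * x)) ≡ q * q * P * x
    left = solve-∀
    right : ∀ t q → t * q * (t * q) ≡ q * (q * (t * t))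
    right = solve-∀

  -- With M = 8m + 1, a triangular m = T(k) would give M = 8T(k) + 1 = (2k+1)².
  J6-nonsquare : ∀ M → M % 8 ≡ 1 → (∀ s → M ≢ s * s) → ℤ.+ 2 ℤ.∣ J6 (ℤ.+ (3 * M))
  J6-nonsquare M M%8 nonsquare = subst (λ M → ℤ.+ 2 ℤ.∣ J6 (ℤ.+ (3 * M))) (sym M≡)
    (even⇒2∣ _ (trans (F-24m+4 m) (ψ-nontriangular m nontriangular)))
    where
    m : ℕ
    m = M / 8
    M≡ : M ≡ 1 + 8 * m
    M≡ = trans (m≡m%n+[m/n]*n M 8) (cong₂ _+_ M%8 (ℕ.*-comm m 8))
    regroup : ∀ t → 1 + 8 * t ≡ 1 + 4 * (t + t)
    regroup = solve-∀
    complete-square : ∀ k → 1 + 4 * (k * suc k) ≡ suc (2 * k) * suc (2 * k)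
    complete-square = solve-∀
    nontriangular : ∀ k → T k ≢ m
    nontriangular k e = nonsquare (suc (2 * k)) (trans M≡ (trans (cong (λ t → 1 + 8 * t) (sym e))
      (trans (regroup (T k)) (trans (cong (λ t → 1 + 4 * t) (T-double k)) (complete-square k)))))

  -- A negative j may make the index negative. The bound on C keeps it at or below -2, away from the
  -- pole term 𝒥₆(-1) = 1, which is odd.
  J6-negative : ∀ C b → 2 ≤ C → ℤ.+ 2 ℤ.∣ J6 (ℤ.+ C ℤ.* -[1+ b ])
  -- Moving the successor to the front exposes the clause of `J6` that returns 0.
  J6-negative (suc (suc C)) b _ = subst (λ x → ℤ.+ 2 ℤ.∣ J6 -[1+ x ]) (sym (ℕ.+-suc b _)) (divides 0 refl)
  J6-negative (suc zero) b (s≤s ())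

  prime∣2*⇒∣ : ∀ {p} → Prime p → ThreeFiveSeven p → ∀ a → p ∣ 2 * a → p ∣ a
  prime∣2*⇒∣ {p} pr c a d with euclidsLemma 2 a pr d
  ... | inj₂ p∣a = p∣a
  ... | inj₁ p∣2 = ⊥-elim (small p (∣⇒≤ p∣2) c)
    where
    small : ∀ p → p ≤ 2 → ¬ ThreeFiveSeven p
    small 0 _ (inj₂ (inj₁ ()))
    small 0 _ (inj₂ (inj₂ ()))
    small 1 _ (inj₂ (inj₁ ()))
    small 1 _ (inj₂ (inj₂ ()))
    small 2 _ (inj₂ (inj₁ ()))
    small 2 _ (inj₂ (inj₂ ()))
    small (suc (suc (suc p))) (s≤s (s≤s ())) _

  prime∣8*⇒∣ : ∀ {p} → Prime p → ThreeFiveSeven p → ∀ a → p ∣ 8 * a → p ∣ a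
  prime∣8*⇒∣ {p} pr c a d = halve a (halve (2 * a) (halve (2 * (2 * a)) (subst (p ∣_) (regroup a) d)))
    where
    halve : ∀ a → p ∣ 2 * a → p ∣ a
    halve = prime∣2*⇒∣ pr c
    regroup : ∀ a → 8 * a ≡ 2 * (2 * (2 * a))
    regroup = solve-∀

  J6-even-multiple : ∀ {k} (ps : Vec ℕ k) p → All Prime ps → All ThreeFiveSeven ps → Prime p → ThreeFiveSeven p →
                     ∀ w → ¬ p ∣ w → w % 8 ≡ p % 8 → ℤ.+ 2 ℤ.∣ J6 (ℤ.+ (3 * prodSq ps * p) ℤ.* ℤ.+ w)
  J6-even-multiple ps p prs cs pr c w p∤w w%8 = subst (λ z → ℤ.+ 2 ℤ.∣ J6 z)
    (trans (cong ℤ.+_ (regroup (prodSq ps) p w)) (ℤ.pos-* (3 * prodSq ps * p) w))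
    (J6-nonsquare (prodSq ps * (p * w))
      (one%8-* (prodSq ps) (p * w) (prodSq%8 ps cs) pw%8)
      (prodSq-*-nonsquare ps prs pr p∤w))
    where
    regroup : ∀ P p w → 3 * (P * (p * w)) ≡ 3 * P * p * w
    regroup = solve-∀
    -- As w and p agree modulo 8, p·w agrees with the odd square p².
    pw%8 : (p * w) % 8 ≡ 1
    pw%8 = trans (%-distribˡ-* p w 8) (trans (cong (λ r → (p % 8 * r) % 8) w%8)
      (trans (sym (%-distribˡ-* p p 8)) (square%8 p c)))

  2≤multiplier : ∀ {P p} .{{_ : NonZero P}} .{{_ : NonZero p}} → 2 ≤ 3 * P * p
  2≤multiplier {P} {p} = ℕ.*-mono-≤ {2} {3 * P} {1} {p}
    (ℕ.*-mono-≤ {2} {3} {1} {P} (s≤s (s≤s z≤n)) (>-nonZero⁻¹ P)) (>-nonZero⁻¹ p)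

  %8-unshift : ∀ {w p} y z → w + y * 8 ≡ p + z * 8 → w % 8 ≡ p % 8
  %8-unshift {w} {p} y z e = trans (sym ([m+kn]%n≡m%n w y 8)) (trans (cong (_% 8) e) ([m+kn]%n≡m%n p z 8))

  J6-even : ∀ {k} n (ps : Vec ℕ k) p → All Prime ps → All ThreeFiveSeven ps → Prime p → ThreeFiveSeven p →
            ∀ j → ¬ p ∣ ℤ.∣ j ∣ →
            ℤ.+ 2 ℤ.∣ J6 (ℤ.+ (3 * prodSq ps * p) ℤ.* (ℤ.+ (8 * p * n) ℤ.+ ℤ.+ 8 ℤ.* j ℤ.+ ℤ.+ p))
  J6-even n ps p prs cs pr c j p∤j = by-sign _ refl
    where
    instance
      p≢0 : NonZero p
      p≢0 = prime⇒nonZero pr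
      P≢0 : NonZero (prodSq ps)
      P≢0 = nonZero (prodSq ps) (prodSq%8 ps cs)
        where
        nonZero : ∀ P → P % 8 ≡ 1 → NonZero P
        nonZero (suc P) _ = _

    -- The number w is 8j modulo p and p modulo 8, and p is odd. For negative j the term 8|j| is
    -- moved to the side of w, so that both congruences can be read in ℕ.
    coprime-residue : ∀ j w → ¬ p ∣ ℤ.∣ j ∣ → ℤ.+ (8 * p * n) ℤ.+ ℤ.+ 8 ℤ.* j ℤ.+ ℤ.+ p ≡ ℤ.+ w →
                      (¬ p ∣ w) × w % 8 ≡ p % 8
    coprime-residue (ℤ.+ a) w p∤j e =
      (λ p∣w → p∤j (prime∣8*⇒∣ pr c a (∣m+n∣m⇒∣n (subst (p ∣_) (trans (sym eq) (divisible n p a)) p∣w) (m∣m*n _)))) ,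
      %8-unshift 0 (p * n + a) (trans (ℕ.+-identityʳ w) (trans (sym eq) (residue n p a)))
      where
      eq : 8 * p * n + 8 * a + p ≡ w
      eq = ℤ.+-injective (trans (cong (λ z → ℤ.+ (8 * p * n) ℤ.+ z ℤ.+ ℤ.+ p) (ℤ.pos-* 8 a)) e)
      divisible : ∀ n p a → 8 * p * n + 8 * a + p ≡ p * (8 * n + 1) + 8 * a
      divisible = solve-∀
      residue : ∀ n p a → 8 * p * n + 8 * a + p ≡ p + (p * n + a) * 8
      residue = solve-∀
    coprime-residue -[1+ a ] w p∤j e =
      (λ p∣w → p∤j (prime∣8*⇒∣ pr c (suc a) (∣m+n∣m⇒∣n (subst (p ∣_) (trans (divisible n p) (sym eq)) (m∣m*n _)) p∣w))) ,
      %8-unshift (suc a) (p * n) (trans (cong (w +_) (ℕ.*-comm (suc a) 8)) (trans eq (residue n p)))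
      where
      cancel : ∀ x j y → x ℤ.+ ℤ.+ 8 ℤ.* j ℤ.+ y ℤ.+ ℤ.+ 8 ℤ.* (ℤ.- j) ≡ x ℤ.+ y
      cancel = ℤ-solve-∀
      eq : w + 8 * suc a ≡ 8 * p * n + p
      eq = ℤ.+-injective (trans (cong₂ ℤ._+_ (sym e) (ℤ.pos-* 8 (suc a))) (cancel (ℤ.+ (8 * p * n)) -[1+ a ] (ℤ.+ p)))
      divisible : ∀ n p → p * (8 * n + 1) ≡ 8 * p * n + p
      divisible = solve-∀
      residue : ∀ n p → 8 * p * n + p ≡ p + p * n * 8
      residue = solve-∀

    by-sign : ∀ w → ℤ.+ (8 * p * n) ℤ.+ ℤ.+ 8 ℤ.* j ℤ.+ ℤ.+ p ≡ w → ℤ.+ 2 ℤ.∣ J6 (ℤ.+ (3 * prodSq ps * p) ℤ.* w)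
    by-sign -[1+ b ] _ = J6-negative (3 * prodSq ps * p) b (2≤multiplier {prodSq ps} {p})
    by-sign (ℤ.+ w) e with p∤w , w%8 ← coprime-residue j w p∤j e = J6-even-multiple ps p prs cs pr c w p∤w w%8

open import Data.Integer using (ℤ; +_; _+_; _*_)
open import Data.Integer.Divisibility using (_∣_)

theorem3p4 : (k n : ℕ) (ps : Vec ℕ k) (p : ℕ) →
  All Prime ps →
  All (λ q → q % 8 ≡ 3 ⊎ q % 8 ≡ 5 ⊎ q % 8 ≡ 7) ps →
  Prime p →
  (p % 8 ≡ 3 ⊎ p % 8 ≡ 5 ⊎ p % 8 ≡ 7) →
  (j : ℤ) → ¬ ((+ p) ∣ j) →
  (+ 2) ∣ J6 (+ (3 Data.Nat.* prodSq ps Data.Nat.* p)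
              * (+ (8 Data.Nat.* p Data.Nat.* n) + + 8 * j + + p))
theorem3p4 _ n ps p prs cs pr c j p∤j = Parity.J6-even n ps p prs cs pr c j p∤j
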